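{- The theory $\mathrm{RCA}_0^{\Omega}$ proves $\mathrm{MUC}\leftrightarrow\mathrm{MUC}^{\mathrm{st}}\leftrightarrow\mathfrak{P}$, where $\mathfrak{P}$ is the statement $$(\forall^{\mathrm{st}}\varphi^{2})(\exists^{\mathrm{st}}x^{0})(\forall f^{1},g^{1}\leq_{1}1)\big[\overline{f}x=_{0}\overline{g}x\to\varphi(f)=_{0}\varphi(g)\big].$$
   Context: BASE THEORY. Finite types: $0$ (natural numbers), $\sigma\to\tau$, and $\sigma^{*}$ (finite sequences of objects of type $\sigma$); $1=0\to 0$, $2=1\to 0$, $3=2\to 0$. Superscripts indicate types; tuples are coded as single objects where convenient. Equality $=_0$ is primitive; for $\tau=\tau_1\to\dots\to\tau_k\to 0$, $x=_\tau y$ means $(\forall z_1\dots z_k)(xz_1\dots z_k=_0 yz_1\dots z_k)$. $\mathrm{RCA}_0^{\omega}$ is Kohlenbach's higher-order base theory: classical arithmetic in all finite types with combinators, zero, successor, the recursor $R_0$ (primitive recursion with type $0$ values), quantifier-free induction, extensionality $x=_\rho y\to\varphi(x)=_\tau\varphi(y)$ for all $\varphi^{\rho\to\tau}$, and $\mathrm{QF\text{ - }AC}^{1,0}$, where $\mathrm{QF\text{ - }AC}^{\sigma,\tau}$ is $(\forall x^\sigma)(\exists y^\tau)A_0(x,y)\to(\exists F^{\sigma\to\tau})(\forall x)A_0(x,F(x))$ for quantifier-free $A_0$. $\mathrm{RCA}_0^{\Omega}$ extends $\mathrm{RCA}_0^{\omega}$ (with the types $\sigma^*$) by a predicate $\mathrm{st}$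 ("is standard") for each type. A formula is internal if it does not contain $\mathrm{st}$; $(\forall^{\mathrm{st}}x)A$ is $(\forall x)(\mathrm{st}(x)\to A)$, $(\exists^{\mathrm{st}}x)A$ is $(\exists x)(\mathrm{st}(x)\wedge A)$; $N\in\Omega$ means $\neg\mathrm{st}(N^0)$; $A^{\mathrm{st}}$ is $A$ with all quantifiers (except bounded number quantifiers) relativised to $\mathrm{st}$. Axioms: (i) standardness respects equality, closed terms are standard, a standard functional applied to a standard object is standard, and numbers below a standard number are standard; (ii) Idealization: $(\forall^{\mathrm{st}}x^{\sigma^*})(\exists y^\tau)(\forall z\in x)\varphi(z,y)\to(\exists y)(\forall^{\mathrm{st}}z^{\sigma})\varphi(z,y)$ for internal $\varphi$; (iii) $\mathrm{HAC}_{\mathrm{int}}$: $(\forall^{\mathrm{st}}x^{\rho})(\exists^{\mathrm{st}}y^{\tau})\varphi(x,y)\to(\exists^{\mathrm{st}}\Phi^{\rho\to\tau^*})(\forall^{\mathrm{st}}x)(\exists y\in\Phi(x))\varphi(x,y)$ for internal $\varphi$; (iv) $\mathrm{PF\text{ - }TP}_\forall$: $(\forall^{\mathrm{st}}x^\tau)\varphi(x)\to(\forall x^\tau)\varphi(x)$ for internal $\varphi(x)$ with no parameters other than $x$; (v) for certain functionals uniquely specified by a parameter-free internal formula, constants with axioms expressing their uniqueness and standardness; these constants do not count as parameters in (iv). In particular there is a constant $\Omega_0^3$ with the axiom $$\mathrm{st}(\Omega_0)\wedge(\forall^{\mathrm{st}}\Xi^3)\big[M^{\mathrm{st}}(\Xi)\to(\forall^{\mathrm{st}}\varphi^2)(\Omega_0(\varphi)=\Xi(\varphi))\big],$$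 where $M(\Omega)$ is the universal formula $(\forall\varphi^2)(\forall f,g\leq_11)[\overline{f}(\Omega(\varphi))=_0\overline{g}(\Omega(\varphi))\to\varphi(f)=_0\varphi(g)]$ together with the requirement that $\Omega(\varphi)$ is minimal. NOTATION. $f\leq_11$ means $f^1$ is a $0$-$1$ sequence; $\overline{f}n$ is the (code of the) initial segment of $f$ of length $n$. PRINCIPLE $\mathrm{MUC}$ (existence of the fan functional): $(\exists\Omega^3)(\forall\varphi^2)(\forall f^1,g^1\leq_11)[\overline{f}(\Omega(\varphi))=_0\overline{g}(\Omega(\varphi))\to\varphi(f)=_0\varphi(g)]$. -}

module Defs where

open import Data.Empty using (⊥)
open import Data.List using (List; []; _∷_; map)
open import Data.List.Membership.Propositional using (_∈_)
open import Data.List.Relation.Binary.Subset.Propositional using (_⊆_)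
open import Data.List.Relation.Unary.Any using (here; there)
open import Data.Product using (_×_)
open import Data.Sum using (_⊎_; inj₁; inj₂; [_,_]′)
open import Data.Unit using (⊤)
open import Function using (id; _∘_)
open import Relation.Binary.PropositionalEquality using (refl)

infixr 30 _⟶_
infix  31 _*
infixl 25 _·_
infix  20 _≐_ _≈_ _≼_ _≺_ _∈̇_
infixr 18 _∧_
infixr 17 _∨_
infixr 16 _⇒_
infix  15 _⇔_
infixl 14 _▸_
infix  10 _∣_⊢[_]_

data Type : Set where
  𝟘   : Type
  _⟶_ : Type → Type → Type
  _*  : Type → Type

𝟙 𝟚 𝟛 : Type
𝟙 = 𝟘 ⟶ 𝟘
𝟚 = 𝟙 ⟶ 𝟘
𝟛 = 𝟚 ⟶ 𝟘

Ctx : Set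
Ctx = List Type

-- N is a family of names for further uniquely specified functionals; which
-- functionals these are is left open until SpecialConstants below.

variable
  N     : Type → Set
  ρ σ τ : Type
  Γ Δ   : Ctx

-- A finite sequence of type σ * is given by a function 𝟘 ⟶ σ and a length:
-- seq f n is ⟨f 0, …, f (n − 1)⟩, len s is the length and at s i the i-th
-- component (0^σ when i is out of range).

data Con (N : Type → Set) : Type → Set where
  Π    : Con N (σ ⟶ τ ⟶ σ)
  Σ    : Con N ((ρ ⟶ σ ⟶ τ) ⟶ (ρ ⟶ σ) ⟶ ρ ⟶ τ)
  O    : Con N 𝟘
  S    : Con N 𝟙
  R₀   : Con N (𝟘 ⟶ 𝟘 ⟶ (𝟘 ⟶ 𝟘 ⟶ 𝟘) ⟶ 𝟘)
  seq  : Con N ((𝟘 ⟶ σ) ⟶ 𝟘 ⟶ σ *)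
  len  : Con N (σ * ⟶ 𝟘)
  at   : Con N (σ * ⟶ 𝟘 ⟶ σ)
  Ω₀   : Con N 𝟛
  name : N σ → Con N σ

data Term (N : Type → Set) (Γ : Ctx) : Type → Set where
  var : σ ∈ Γ → Term N Γ σ
  con : Con N σ → Term N Γ σ
  _·_ : Term N Γ (σ ⟶ τ) → Term N Γ σ → Term N Γ τ

v₀ : Term N (σ ∷ Γ) σ
v₀ = var (here refl)

v₁ : Term N (ρ ∷ σ ∷ Γ) σ
v₁ = var (there (here refl))

v₂ : Term N (ρ ∷ τ ∷ σ ∷ Γ) σ
v₂ = var (there (there (here refl)))

renᵗ : Γ ⊆ Δ → Term N Γ σ → Term N Δ σ
renᵗ r (var x) = var (r x)
renᵗ r (con c) = con c
renᵗ r (s · t) = renᵗ r s · renᵗ r t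

wk : Term N Γ σ → Term N (τ ∷ Γ) σ
wk = renᵗ there

Sub : (Type → Set) → Ctx → Ctx → Set
Sub N Γ Δ = ∀ {σ} → σ ∈ Γ → Term N Δ σ

subᵗ : Sub N Γ Δ → Term N Γ σ → Term N Δ σ
subᵗ s (var x) = s x
subᵗ s (con c) = con c
subᵗ s (t · u) = subᵗ s t · subᵗ s u

_▸_ : Sub N Γ Δ → Term N Δ σ → Sub N (σ ∷ Γ) Δ
(s ▸ t) (here refl) = t
(s ▸ t) (there x)   = s x

lift : Sub N Γ Δ → Sub N (σ ∷ Γ) (σ ∷ Δ)
lift s = (λ x → wk (s x)) ▸ v₀

↑₁ : Sub N Γ (σ ∷ Γ)
↑₁ x = var (there x)

↑₂ : Sub N Γ (ρ ∷ σ ∷ Γ)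
↑₂ x = var (there (there x))

↑₃ : Sub N Γ (ρ ∷ σ ∷ τ ∷ Γ)
↑₃ x = var (there (there (there x)))

-- Bracket abstraction: inj₁ t′ means that the most recent variable does not
-- occur (and t′ is the strengthened term); inj₂ is the abstracted term.
-- Testing for occurrence makes ƛ commute with substitution on the nose.

const′ : Term N Γ τ ⊎ Term N Γ (σ ⟶ τ) → Term N Γ (σ ⟶ τ)
const′ = [ con Π ·_ , id ]′

abstr : Term N (σ ∷ Γ) τ → Term N Γ τ ⊎ Term N Γ (σ ⟶ τ)
abstr {σ = σ} (var (here refl)) = inj₂ (con Σ · con Π · con (Π {τ = σ}))
abstr (var (there x)) = inj₁ (var x)
abstr (con c)         = inj₁ (con c)
abstr (s · t) with abstr s | abstr t
... | inj₁ s′ | inj₁ t′ = inj₁ (s′ · t′)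
... | s′      | t′      = inj₂ (con Σ · const′ s′ · const′ t′)

ƛ : Term N (σ ∷ Γ) τ → Term N Γ (σ ⟶ τ)
ƛ = const′ ∘ abstr

zer : Term N Γ 𝟘
zer = con O

suc′ : Term N Γ 𝟘 → Term N Γ 𝟘
suc′ t = con S · t

-- The step function of R₀ takes the previous value first, then the index.

add : Term N Γ (𝟘 ⟶ 𝟘 ⟶ 𝟘)
add = ƛ (ƛ (con R₀ · v₀ · v₁ · ƛ (ƛ (suc′ v₁))))

pred′ : Term N Γ 𝟙
pred′ = ƛ (con R₀ · v₀ · zer · ƛ (ƛ v₀))

monus : Term N Γ (𝟘 ⟶ 𝟘 ⟶ 𝟘)
monus = ƛ (ƛ (con R₀ · v₀ · v₁ · ƛ (ƛ (pred′ · v₁))))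

-- tri · n = 0 + 1 + … + n

tri : Term N Γ 𝟙
tri = ƛ (con R₀ · v₀ · zer · ƛ (ƛ (add · v₁ · suc′ v₀)))

-- Cantor's pairing function.

pair : Term N Γ (𝟘 ⟶ 𝟘 ⟶ 𝟘)
pair = ƛ (ƛ (add · (tri · (add · v₁ · v₀)) · v₀))

-- Codes of initial segments: the empty sequence has code 0, and appending a
-- to a sequence with code c gives the code pair c a + 1.

initial : Term N Γ (𝟙 ⟶ 𝟘 ⟶ 𝟘)
initial = ƛ (ƛ (con R₀ · v₀ · zer · ƛ (ƛ (suc′ (pair · v₁ · (wk (wk v₁) · v₀))))))

bar : Term N Γ 𝟙 → Term N Γ 𝟘 → Term N Γ 𝟘
bar f n = initial · f · n

zeroOf : ∀ σ → Term N Γ σ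
zeroOf 𝟘       = zer
zeroOf (σ ⟶ τ) = con Π · zeroOf τ
zeroOf (σ *)   = con seq · (con Π · zeroOf σ) · zer

-- Bounded number quantifiers are primitive, since relativisation to st
-- treats them separately.

data Fm (N : Type → Set) (Γ : Ctx) : Set where
  ⊥̇     : Fm N Γ
  _≐_   : Term N Γ 𝟘 → Term N Γ 𝟘 → Fm N Γ
  st    : Term N Γ σ → Fm N Γ
  _∧_ _∨_ _⇒_ : Fm N Γ → Fm N Γ → Fm N Γ
  ∀̇ ∃̇   : Fm N (σ ∷ Γ) → Fm N Γ
  ∀< ∃< : Term N Γ 𝟘 → Fm N (𝟘 ∷ Γ) → Fm N Γ

¬̇_ : Fm N Γ → Fm N Γ
¬̇ A = A ⇒ ⊥̇

_⇔_ : Fm N Γ → Fm N Γ → Fm N Γ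
A ⇔ B = (A ⇒ B) ∧ (B ⇒ A)

∀ˢᵗ ∃ˢᵗ : Fm N (σ ∷ Γ) → Fm N Γ
∀ˢᵗ A = ∀̇ (st v₀ ⇒ A)
∃ˢᵗ A = ∃̇ (st v₀ ∧ A)

sub : Sub N Γ Δ → Fm N Γ → Fm N Δ
sub s ⊥̇       = ⊥̇
sub s (t ≐ u)  = subᵗ s t ≐ subᵗ s u
sub s (st t)   = st (subᵗ s t)
sub s (A ∧ B)  = sub s A ∧ sub s B
sub s (A ∨ B)  = sub s A ∨ sub s B
sub s (A ⇒ B)  = sub s A ⇒ sub s B
sub s (∀̇ A)    = ∀̇ (sub (lift s) A)
sub s (∃̇ A)    = ∃̇ (sub (lift s) A)
sub s (∀< t A) = ∀< (subᵗ s t) (sub (lift s) A)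
sub s (∃< t A) = ∃< (subᵗ s t) (sub (lift s) A)

wkᶠ : Fm N Γ → Fm N (σ ∷ Γ)
wkᶠ = sub ↑₁

_[_] : Fm N (σ ∷ Γ) → Term N Γ σ → Fm N Γ
A [ t ] = sub (var ▸ t) A

fromClosedᵗ : Term N [] σ → Term N Γ σ
fromClosedᵗ = renᵗ λ ()

fromClosed : Fm N [] → Fm N Γ
fromClosed = sub λ ()

_ˢᵗ : Fm N Γ → Fm N Γ
⊥̇ ˢᵗ       = ⊥̇
(t ≐ u) ˢᵗ  = t ≐ u
(st t) ˢᵗ   = st t
(A ∧ B) ˢᵗ  = A ˢᵗ ∧ B ˢᵗ
(A ∨ B) ˢᵗ  = A ˢᵗ ∨ B ˢᵗ
(A ⇒ B) ˢᵗ  = A ˢᵗ ⇒ B ˢᵗ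
(∀̇ A) ˢᵗ    = ∀ˢᵗ (A ˢᵗ)
(∃̇ A) ˢᵗ    = ∃ˢᵗ (A ˢᵗ)
(∀< t A) ˢᵗ = ∀< t (A ˢᵗ)
(∃< t A) ˢᵗ = ∃< t (A ˢᵗ)

Internal : Fm N Γ → Set
Internal ⊥̇       = ⊤
Internal (t ≐ u)  = ⊤
Internal (st t)   = ⊥
Internal (A ∧ B)  = Internal A × Internal B
Internal (A ∨ B)  = Internal A × Internal B
Internal (A ⇒ B)  = Internal A × Internal B
Internal (∀̇ A)    = Internal A
Internal (∃̇ A)    = Internal A
Internal (∀< t A) = Internal A
Internal (∃< t A) = Internal A

QuantifierFree : Fm N Γ → Set
QuantifierFree ⊥̇       = ⊤
QuantifierFree (t ≐ u)  = ⊤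
QuantifierFree (st t)   = ⊥
QuantifierFree (A ∧ B)  = QuantifierFree A × QuantifierFree B
QuantifierFree (A ∨ B)  = QuantifierFree A × QuantifierFree B
QuantifierFree (A ⇒ B)  = QuantifierFree A × QuantifierFree B
QuantifierFree (∀̇ A)    = ⊥
QuantifierFree (∃̇ A)    = ⊥
QuantifierFree (∀< t A) = ⊥
QuantifierFree (∃< t A) = ⊥

_≼_ _≺_ : Term N Γ 𝟘 → Term N Γ 𝟘 → Fm N Γ
s ≼ t = monus · s · t ≐ zer
s ≺ t = suc′ s ≼ t

-- Equality at all types; at function types this unfolds to
-- (∀ z₁ … z_k) (x z₁ … z_k = y z₁ … z_k).

_≈_ : Term N Γ σ → Term N Γ σ → Fm N Γ
_≈_ {σ = 𝟘}     s t = s ≐ t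
_≈_ {σ = σ ⟶ τ} s t = ∀̇ (wk s · v₀ ≈ wk t · v₀)
_≈_ {σ = σ *}   s t = (con len · s ≐ con len · t)
                    ∧ ∀< (con len · s) (con at · wk s · v₀ ≈ con at · wk t · v₀)

_∈̇_ : Term N Γ σ → Term N Γ (σ *) → Fm N Γ
z ∈̇ s = ∃< (con len · s) (wk z ≈ con at · wk s · v₀)

-- f ≤₁ 1
Binary : Term N Γ 𝟙 → Fm N Γ
Binary f = ∀̇ (wk f · v₀ ≼ suc′ zer)

-- (∀ f, g ≤₁ 1) [ f̄ n = ḡ n → φ f = φ g ]
IsModulus : Term N Γ 𝟚 → Term N Γ 𝟘 → Fm N Γ
IsModulus φ n =
  ∀̇ (∀̇ (Binary v₁ ∧ Binary v₀
        ⇒ (bar v₁ (wk (wk n)) ≐ bar v₀ (wk (wk n))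
        ⇒ wk (wk φ) · v₁ ≐ wk (wk φ) · v₀)))

MUC : Fm N Γ
MUC = ∃̇ {σ = 𝟛} (∀̇ {σ = 𝟚} (IsModulus v₀ (v₁ · v₀)))

-- M(Ω): Ω yields a modulus of uniform continuity, and Ω(φ) is the least one.
M : Fm N (𝟛 ∷ Γ)
M = ∀̇ {σ = 𝟚} (IsModulus v₀ (v₁ · v₀))
  ∧ ∀̇ {σ = 𝟚} (∀̇ {σ = 𝟘} (IsModulus v₁ v₀ ⇒ v₂ · v₁ ≼ v₀))

𝔓 : Fm N Γ
𝔓 = ∀ˢᵗ {σ = 𝟚} (∃ˢᵗ {σ = 𝟘} (IsModulus v₁ v₀))

-- The functionals other than Ω₀ for which there are constants, each with its
-- specifying parameter-free internal formula.  Specifications may mention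
-- Ω₀ and other names, since constants do not count as parameters.

record SpecialConstants : Set₁ where
  field
    Name          : Type → Set
    spec          : Name σ → Fm Name (σ ∷ [])
    spec-internal : (c : Name σ) → Internal (spec c)

-- st(c) ∧ (∀^st Ξ) [ A^st(Ξ) → (c = Ξ)^st ]

UniqueStandard : Con N σ → Fm N (σ ∷ []) → Fm N []
UniqueStandard c A = st (con c) ∧ ∀ˢᵗ (A ˢᵗ ⇒ (con c ≈ v₀) ˢᵗ)

-- Schemata are stated for arbitrary terms and for formulas in an arbitrary
-- context Γ, whose variables are the parameters.

data RCA₀^ω {N : Type → Set} {Γ : Ctx} : Fm N Γ → Set where
  Π-eq : (x : Term N Γ σ) (y : Term N Γ τ) → RCA₀^ω (con Π · x · y ≈ x)
  Σ-eq : (x : Term N Γ (ρ ⟶ σ ⟶ τ)) (y : Term N Γ (ρ ⟶ σ)) (z : Term N Γ ρ) →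
         RCA₀^ω (con Σ · x · y · z ≈ x · z · (y · z))

  S≠0   : (m : Term N Γ 𝟘) → RCA₀^ω (¬̇ (suc′ m ≐ zer))
  S-inj : (m n : Term N Γ 𝟘) → RCA₀^ω (suc′ m ≐ suc′ n ⇒ m ≐ n)

  R₀-zero : (y : Term N Γ 𝟘) (z : Term N Γ (𝟘 ⟶ 𝟘 ⟶ 𝟘)) →
            RCA₀^ω (con R₀ · zer · y · z ≐ y)
  R₀-suc  : (x y : Term N Γ 𝟘) (z : Term N Γ (𝟘 ⟶ 𝟘 ⟶ 𝟘)) →
            RCA₀^ω (con R₀ · suc′ x · y · z ≐ z · (con R₀ · x · y · z) · x)

  QF-induction : (A : Fm N (𝟘 ∷ Γ)) → QuantifierFree A →
                 RCA₀^ω (A [ zer ] ∧ ∀̇ (A ⇒ sub (↑₁ ▸ suc′ v₀) A) ⇒ ∀̇ A)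

  extensionality : (φ : Term N Γ (ρ ⟶ τ)) (x y : Term N Γ ρ) →
                   RCA₀^ω (x ≈ y ⇒ φ · x ≈ φ · y)

  QF-AC¹⁰ : (A : Fm N (𝟘 ∷ 𝟙 ∷ Γ)) → QuantifierFree A →
            RCA₀^ω (∀̇ (∃̇ A) ⇒ ∃̇ {σ = 𝟙 ⟶ 𝟘} (∀̇ (sub (↑₂ ▸ v₀ ▸ v₁ · v₀) A)))

  len-seq : (f : Term N Γ (𝟘 ⟶ σ)) (n : Term N Γ 𝟘) →
            RCA₀^ω (con len · (con seq · f · n) ≐ n)
  at-seq  : (f : Term N Γ (𝟘 ⟶ σ)) (n i : Term N Γ 𝟘) →
            RCA₀^ω (i ≺ n ⇒ con at · (con seq · f · n) · i ≈ f · i)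
  at-out  : (s : Term N Γ (σ *)) (i : Term N Γ 𝟘) →
            RCA₀^ω (con len · s ≼ i ⇒ con at · s · i ≈ zeroOf σ)

module _ (𝒮 : SpecialConstants) where
  open SpecialConstants 𝒮

  data RCA₀^Ω {Γ : Ctx} : Fm Name Γ → Set where
    base : {A : Fm Name Γ} → RCA₀^ω A → RCA₀^Ω A

    st-≈      : (x y : Term Name Γ σ) → RCA₀^Ω (x ≈ y ⇒ st x ⇒ st y)
    st-closed : (t : Term Name [] σ) → RCA₀^Ω (st (fromClosedᵗ t))
    st-app    : (f : Term Name Γ (σ ⟶ τ)) (x : Term Name Γ σ) →
                RCA₀^Ω (st f ⇒ st x ⇒ st (f · x))
    st-≼      : (m n : Term Name Γ 𝟘) → RCA₀^Ω (m ≼ n ⇒ st n ⇒ st m)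

    -- In φ(z, y) and φ(x, y) the variable y is v₀, and z or x is v₁.

    idealization : (φ : Fm Name (τ ∷ σ ∷ Γ)) → Internal φ →
      RCA₀^Ω (∀ˢᵗ {σ = σ *} (∃̇ {σ = τ} (∀̇ {σ = σ} (v₀ ∈̇ v₂ ⇒ sub (↑₃ ▸ v₀ ▸ v₁) φ)))
              ⇒ ∃̇ {σ = τ} (∀ˢᵗ {σ = σ} (sub (↑₂ ▸ v₀ ▸ v₁) φ)))

    HAC-int : (φ : Fm Name (τ ∷ ρ ∷ Γ)) → Internal φ →
      RCA₀^Ω (∀ˢᵗ {σ = ρ} (∃ˢᵗ {σ = τ} φ)
              ⇒ ∃ˢᵗ {σ = ρ ⟶ τ *} (∀ˢᵗ {σ = ρ} (∃̇ {σ = τ}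
                  (v₀ ∈̇ v₂ · v₁ ∧ sub (↑₃ ▸ v₁ ▸ v₀) φ))))

    PF-TP∀ : (φ : Fm Name (τ ∷ [])) → Internal φ →
             RCA₀^Ω (fromClosed (∀ˢᵗ φ ⇒ ∀̇ φ))

    Ω₀-axiom   : RCA₀^Ω (fromClosed (UniqueStandard Ω₀ M))
    name-axiom : (c : Name σ) → RCA₀^Ω (fromClosed (UniqueStandard (name c) (spec c)))

-- Γ ∣ H ⊢[ Ax ] A: A is derivable from the hypotheses H and the axioms Ax, where
-- the free variables of H and A are among Γ.

data _∣_⊢[_]_ {N : Type → Set} (Γ : Ctx) (H : List (Fm N Γ))
              (Ax : ∀ {Γ} → Fm N Γ → Set) : Fm N Γ → Set where
  ax  : ∀ {A} → Ax A → Γ ∣ H ⊢[ Ax ] A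
  hyp : ∀ {A} → A ∈ H → Γ ∣ H ⊢[ Ax ] A

  raa : ∀ {A} → Γ ∣ (¬̇ A) ∷ H ⊢[ Ax ] ⊥̇ → Γ ∣ H ⊢[ Ax ] A

  ⇒I : ∀ {A B} → Γ ∣ A ∷ H ⊢[ Ax ] B → Γ ∣ H ⊢[ Ax ] (A ⇒ B)
  ⇒E : ∀ {A B} → Γ ∣ H ⊢[ Ax ] (A ⇒ B) → Γ ∣ H ⊢[ Ax ] A → Γ ∣ H ⊢[ Ax ] B

  ∧I  : ∀ {A B} → Γ ∣ H ⊢[ Ax ] A → Γ ∣ H ⊢[ Ax ] B → Γ ∣ H ⊢[ Ax ] (A ∧ B)
  ∧E₁ : ∀ {A B} → Γ ∣ H ⊢[ Ax ] (A ∧ B) → Γ ∣ H ⊢[ Ax ] A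
  ∧E₂ : ∀ {A B} → Γ ∣ H ⊢[ Ax ] (A ∧ B) → Γ ∣ H ⊢[ Ax ] B

  ∨I₁ : ∀ {A B} → Γ ∣ H ⊢[ Ax ] A → Γ ∣ H ⊢[ Ax ] (A ∨ B)
  ∨I₂ : ∀ {A B} → Γ ∣ H ⊢[ Ax ] B → Γ ∣ H ⊢[ Ax ] (A ∨ B)
  ∨E  : ∀ {A B C} → Γ ∣ H ⊢[ Ax ] (A ∨ B) →
        Γ ∣ A ∷ H ⊢[ Ax ] C → Γ ∣ B ∷ H ⊢[ Ax ] C → Γ ∣ H ⊢[ Ax ] C

  ∀I : ∀ {σ A} → (σ ∷ Γ) ∣ map wkᶠ H ⊢[ Ax ] A → Γ ∣ H ⊢[ Ax ] ∀̇ A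
  ∀E : ∀ {σ} {A : Fm N (σ ∷ Γ)} →
       Γ ∣ H ⊢[ Ax ] ∀̇ A → (t : Term N Γ σ) → Γ ∣ H ⊢[ Ax ] (A [ t ])

  ∃I : ∀ {σ} {A : Fm N (σ ∷ Γ)} (t : Term N Γ σ) →
       Γ ∣ H ⊢[ Ax ] (A [ t ]) → Γ ∣ H ⊢[ Ax ] ∃̇ A
  ∃E : ∀ {σ} {A : Fm N (σ ∷ Γ)} {C} → Γ ∣ H ⊢[ Ax ] ∃̇ A →
       (σ ∷ Γ) ∣ A ∷ map wkᶠ H ⊢[ Ax ] wkᶠ C → Γ ∣ H ⊢[ Ax ] C

  ∀<-def : ∀ t A → Γ ∣ H ⊢[ Ax ] (∀< t A ⇔ ∀̇ (v₀ ≺ wk t ⇒ A))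
  ∃<-def : ∀ t A → Γ ∣ H ⊢[ Ax ] (∃< t A ⇔ ∃̇ (v₀ ≺ wk t ∧ A))

  ≐-refl  : ∀ t → Γ ∣ H ⊢[ Ax ] (t ≐ t)
  ≐-subst : ∀ {s t} (A : Fm N (𝟘 ∷ Γ)) →
            Γ ∣ H ⊢[ Ax ] (s ≐ t) → Γ ∣ H ⊢[ Ax ] (A [ s ]) → Γ ∣ H ⊢[ Ax ] (A [ t ])

RCA₀^Ω-Proves : (𝒮 : SpecialConstants) →
                Fm (SpecialConstants.Name 𝒮) [] → Set
RCA₀^Ω-Proves 𝒮 A = [] ∣ [] ⊢[ RCA₀^Ω 𝒮 ] A

{-# OPTIONS --safe #-}
-- The three statements are proved equivalent in the cycle MUC ⇒ 𝔓 ⇒ MUC^st ⇒ MUC.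
--
-- MUC ⇒ 𝔓: PF-TP∀, read contrapositively, makes the fan functional standard, and
-- its value at a standard φ is a standard modulus.
--
-- 𝔓 ⇒ MUC^st: HAC-int gives a standard function listing candidate moduli, and the
-- sum of the candidates is a modulus.  What remains is that a standard f which is
-- 0-1 valued only at standard arguments may have other values elsewhere.  But 𝔓 for
-- X ↦ φ(f where X = 0, sg ∘ f where X ≠ 0) yields φ(f) = φ(sg ∘ f): compare X = 0
-- with the X that jumps to 1 at the (standard) modulus, below which f = sg ∘ f.
--
-- MUC^st ⇒ MUC: if n is a modulus of φ on standard sequences, then on these φ only
-- takes its values at the sequences of binary digits of numbers below a bound which
-- depends on n.  Being a modulus is thus decidable by bounded search, so that the
-- standard fan functional can be replaced by one with least values, to which the
-- axiom for Ω₀ applies.  As Ω₀ is a constant, PF-TP∀ transfers its modulus property.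
module Submission where

open import Defs
open import Data.List using (List; []; _∷_; map)
open import Data.List.Membership.Propositional using (_∈_)
open import Data.List.Relation.Binary.Subset.Propositional using (_⊆_)
open import Data.List.Relation.Unary.Any using (here; there)
open import Data.Sum using (_⊎_; inj₁; inj₂)
open import Relation.Binary.PropositionalEquality
  using (_≡_; refl; sym; trans; cong; cong₂; subst)

private variable
  Θ : Ctx

-- Substitution calculus for terms and formulas.

subᵗ-cong : {s s′ : Sub N Γ Δ} → (∀ {σ} (x : σ ∈ Γ) → s x ≡ s′ x) →
            (t : Term N Γ τ) → subᵗ s t ≡ subᵗ s′ t
subᵗ-cong e (var x) = e x
subᵗ-cong e (con c) = refl
subᵗ-cong e (t · u) = cong₂ _·_ (subᵗ-cong e t) (subᵗ-cong e u)

subᵗ-var : (t : Term N Γ τ) → subᵗ var t ≡ t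
subᵗ-var (var x) = refl
subᵗ-var (con c) = refl
subᵗ-var (t · u) = cong₂ _·_ (subᵗ-var t) (subᵗ-var u)

subᵗ-renᵗ : (s : Sub N Δ Θ) (r : Γ ⊆ Δ) (t : Term N Γ τ) →
            subᵗ s (renᵗ r t) ≡ subᵗ (λ x → s (r x)) t
subᵗ-renᵗ s r (var x) = refl
subᵗ-renᵗ s r (con c) = refl
subᵗ-renᵗ s r (t · u) = cong₂ _·_ (subᵗ-renᵗ s r t) (subᵗ-renᵗ s r u)

renᵗ-subᵗ : (r : Δ ⊆ Θ) (s : Sub N Γ Δ) (t : Term N Γ τ) →
            renᵗ r (subᵗ s t) ≡ subᵗ (λ x → renᵗ r (s x)) t
renᵗ-subᵗ r s (var x) = refl
renᵗ-subᵗ r s (con c) = refl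
renᵗ-subᵗ r s (t · u) = cong₂ _·_ (renᵗ-subᵗ r s t) (renᵗ-subᵗ r s u)

subᵗ-subᵗ : (s : Sub N Δ Θ) (s′ : Sub N Γ Δ) (t : Term N Γ τ) →
            subᵗ s (subᵗ s′ t) ≡ subᵗ (λ x → subᵗ s (s′ x)) t
subᵗ-subᵗ s s′ (var x) = refl
subᵗ-subᵗ s s′ (con c) = refl
subᵗ-subᵗ s s′ (t · u) = cong₂ _·_ (subᵗ-subᵗ s s′ t) (subᵗ-subᵗ s s′ u)

subᵗ-↑₁ : (t : Term N Γ τ) → subᵗ (↑₁ {σ = σ}) t ≡ wk t
subᵗ-↑₁ (var x) = refl
subᵗ-↑₁ (con c) = refl
subᵗ-↑₁ (t · u) = cong₂ _·_ (subᵗ-↑₁ t) (subᵗ-↑₁ u)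

subᵗ-▸-wk : (s : Sub N Γ Δ) (u : Term N Δ σ) (t : Term N Γ τ) →
            subᵗ (s ▸ u) (wk t) ≡ subᵗ s t
subᵗ-▸-wk s u t = subᵗ-renᵗ (s ▸ u) there t

wk-[] : (u : Term N Γ σ) (t : Term N Γ τ) → subᵗ (var ▸ u) (wk t) ≡ t
wk-[] u t = trans (subᵗ-▸-wk var u t) (subᵗ-var t)

subᵗ-lift-wk : (s : Sub N Γ Δ) (t : Term N Γ τ) →
               subᵗ (lift {σ = σ} s) (wk t) ≡ wk (subᵗ s t)
subᵗ-lift-wk s t = trans (subᵗ-renᵗ (lift s) there t) (sym (renᵗ-subᵗ there s t))

lift-cong : {s s′ : Sub N Γ Δ} → (∀ {σ} (x : σ ∈ Γ) → s x ≡ s′ x) →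
            ∀ {τ} (x : τ ∈ σ ∷ Γ) → lift s x ≡ lift s′ x
lift-cong e (here refl) = refl
lift-cong e (there x)   = cong wk (e x)

lift-subᵗ : (s : Sub N Δ Θ) (s′ : Sub N Γ Δ) →
            ∀ {τ} (x : τ ∈ σ ∷ Γ) →
            subᵗ (lift s) (lift s′ x) ≡ lift (λ y → subᵗ s (s′ y)) x
lift-subᵗ s s′ (here refl) = refl
lift-subᵗ s s′ (there x)   = subᵗ-lift-wk s (s′ x)

sub-cong : {s s′ : Sub N Γ Δ} → (∀ {σ} (x : σ ∈ Γ) → s x ≡ s′ x) →
           (A : Fm N Γ) → sub s A ≡ sub s′ A
sub-cong e ⊥̇        = refl
sub-cong e (t ≐ u)  = cong₂ _≐_ (subᵗ-cong e t) (subᵗ-cong e u)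
sub-cong e (st t)   = cong st (subᵗ-cong e t)
sub-cong e (A ∧ B)  = cong₂ _∧_ (sub-cong e A) (sub-cong e B)
sub-cong e (A ∨ B)  = cong₂ _∨_ (sub-cong e A) (sub-cong e B)
sub-cong e (A ⇒ B)  = cong₂ _⇒_ (sub-cong e A) (sub-cong e B)
sub-cong e (∀̇ A)    = cong ∀̇ (sub-cong (lift-cong e) A)
sub-cong e (∃̇ A)    = cong ∃̇ (sub-cong (lift-cong e) A)
sub-cong e (∀< t A) = cong₂ ∀< (subᵗ-cong e t) (sub-cong (lift-cong e) A)
sub-cong e (∃< t A) = cong₂ ∃< (subᵗ-cong e t) (sub-cong (lift-cong e) A)

sub-sub : (s : Sub N Δ Θ) (s′ : Sub N Γ Δ) (A : Fm N Γ) →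
          sub s (sub s′ A) ≡ sub (λ x → subᵗ s (s′ x)) A
sub-sub-lift : (s : Sub N Δ Θ) (s′ : Sub N Γ Δ) (A : Fm N (σ ∷ Γ)) →
               sub (lift s) (sub (lift s′) A) ≡ sub (lift (λ x → subᵗ s (s′ x))) A
sub-sub-lift s s′ A = trans (sub-sub (lift s) (lift s′) A) (sub-cong (lift-subᵗ s s′) A)
sub-sub s s′ ⊥̇        = refl
sub-sub s s′ (t ≐ u)  = cong₂ _≐_ (subᵗ-subᵗ s s′ t) (subᵗ-subᵗ s s′ u)
sub-sub s s′ (st t)   = cong st (subᵗ-subᵗ s s′ t)
sub-sub s s′ (A ∧ B)  = cong₂ _∧_ (sub-sub s s′ A) (sub-sub s s′ B)
sub-sub s s′ (A ∨ B)  = cong₂ _∨_ (sub-sub s s′ A) (sub-sub s s′ B)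
sub-sub s s′ (A ⇒ B)  = cong₂ _⇒_ (sub-sub s s′ A) (sub-sub s s′ B)
sub-sub s s′ (∀̇ A)    = cong ∀̇ (sub-sub-lift s s′ A)
sub-sub s s′ (∃̇ A)    = cong ∃̇ (sub-sub-lift s s′ A)
sub-sub s s′ (∀< t A) = cong₂ ∀< (subᵗ-subᵗ s s′ t) (sub-sub-lift s s′ A)
sub-sub s s′ (∃< t A) = cong₂ ∃< (subᵗ-subᵗ s s′ t) (sub-sub-lift s s′ A)

-- Induction on the type: `_≈_` is defined by recursion on σ, so for a type variable substitution
-- does not compute through it.
sub-≈ : (s : Sub N Γ Δ) (t u : Term N Γ σ) → sub s (t ≈ u) ≡ (subᵗ s t ≈ subᵗ s u)
sub-≈ {σ = 𝟘}     s t u = refl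
sub-≈ {σ = σ ⟶ τ} s t u = cong ∀̇
  (trans (sub-≈ (lift s) (wk t · v₀) (wk u · v₀))
         (cong₂ (λ t′ u′ → t′ · v₀ ≈ u′ · v₀) (subᵗ-lift-wk s t) (subᵗ-lift-wk s u)))
sub-≈ {σ = σ *}   s t u = cong ((con len · subᵗ s t ≐ con len · subᵗ s u) ∧_)
  (cong (∀< (con len · subᵗ s t))
  (trans (sub-≈ (lift s) (con at · wk t · v₀) (con at · wk u · v₀))
         (cong₂ (λ t′ u′ → con at · t′ · v₀ ≈ con at · u′ · v₀)
                (subᵗ-lift-wk s t) (subᵗ-lift-wk s u))))

-- Repeated `∀E` leaves an instantiation outside a lifted substitution. Merging the two into one
-- substitution gives a formula that computes as soon as A is concrete.
sub-lift-▸ : (s : Sub N Γ Δ) (u : Term N Δ σ) (A : Fm N (σ ∷ Γ)) →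
             sub (lift s) A [ u ] ≡ sub (s ▸ u) A
sub-lift-▸ s u A = trans (sub-sub (var ▸ u) (lift s) A) (sub-cong e A)
  where
  e : ∀ {τ} (x : τ ∈ _ ∷ _) → subᵗ (var ▸ u) (lift s x) ≡ (s ▸ u) x
  e (here refl) = refl
  e (there x)   = wk-[] u (s x)

module Derivations (𝒮 : SpecialConstants) where
  open SpecialConstants 𝒮 using (Name)

  -- Derived rules, and equality at all types.

  infix  4 _⊢_
  infixr 2 _≐⟨_⟩_ _≐⟨_⟨_
  infix  3 _■

  _⊢_ : List (Fm Name Γ) → Fm Name Γ → Set
  H ⊢ A = _ ∣ H ⊢[ RCA₀^Ω 𝒮 ] A

  private variable
    H : List (Fm Name Γ)
    A B A₀ A₁ A₂ A₃ A₄ A₅ A₆ : Fm Name Γ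
    s t u s′ t′ f g : Term Name Γ σ

  h₀ : A ∷ H ⊢ A
  h₀ = hyp (here refl)
  h₁ : A₀ ∷ A ∷ H ⊢ A
  h₁ = hyp (there (here refl))
  h₂ : A₀ ∷ A₁ ∷ A ∷ H ⊢ A
  h₂ = hyp (there (there (here refl)))
  h₃ : A₀ ∷ A₁ ∷ A₂ ∷ A ∷ H ⊢ A
  h₃ = hyp (there (there (there (here refl))))
  h₄ : A₀ ∷ A₁ ∷ A₂ ∷ A₃ ∷ A ∷ H ⊢ A
  h₄ = hyp (there (there (there (there (here refl)))))
  h₅ : A₀ ∷ A₁ ∷ A₂ ∷ A₃ ∷ A₄ ∷ A ∷ H ⊢ A
  h₅ = hyp (there (there (there (there (there (here refl))))))
  h₆ : A₀ ∷ A₁ ∷ A₂ ∷ A₃ ∷ A₄ ∷ A₅ ∷ A ∷ H ⊢ A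
  h₆ = hyp (there (there (there (there (there (there (here refl)))))))

  h₇ : A₀ ∷ A₁ ∷ A₂ ∷ A₃ ∷ A₄ ∷ A₅ ∷ A₆ ∷ A ∷ H ⊢ A
  h₇ = hyp (there (there (there (there (there (there (there (here refl))))))))

  cut : H ⊢ A → A ∷ H ⊢ B → H ⊢ B
  cut p q = ⇒E (⇒I q) p

  exfalso : H ⊢ ⊥̇ → H ⊢ A
  exfalso p = ⇒E (⇒I (raa h₁)) p

  -- Serves a pattern used throughout: a fact about arbitrary terms is first derived as a
  -- universally quantified formula about variables, where weakenings and substitutions compute
  -- away, and is then instantiated.
  inst₂ : {A : Fm Name (τ ∷ σ ∷ Γ)} → H ⊢ ∀̇ (∀̇ A) → ∀ s t → H ⊢ sub (var ▸ s ▸ t) A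
  inst₂ {A = A} p s t = subst (_ ⊢_) (sub-lift-▸ (var ▸ s) t A) (∀E (∀E p s) t)

  inst₃ : {A : Fm Name (ρ ∷ τ ∷ σ ∷ Γ)} → H ⊢ ∀̇ (∀̇ (∀̇ A)) →
          ∀ s t u → H ⊢ sub (var ▸ s ▸ t ▸ u) A
  inst₃ {A = A} p s t u =
    subst (_ ⊢_) (sub-lift-▸ (var ▸ s ▸ t) u A) (∀E (inst₂ p s t) u)

  inst₄ : {ρ′ : Type} {A : Fm Name (ρ′ ∷ ρ ∷ τ ∷ σ ∷ Γ)} → H ⊢ ∀̇ (∀̇ (∀̇ (∀̇ A))) →
          ∀ s t u w → H ⊢ sub (var ▸ s ▸ t ▸ u ▸ w) A
  inst₄ {A = A} p s t u w =
    subst (_ ⊢_) (sub-lift-▸ (var ▸ s ▸ t ▸ u) w A) (∀E (inst₃ p s t u) w)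

  ≐-sym : H ⊢ s ≐ t → H ⊢ t ≐ s
  ≐-sym {s = s} {t} p =
    subst (λ z → _ ⊢ t ≐ z) (wk-[] t s)
      (≐-subst (v₀ ≐ wk s) p (subst (λ z → _ ⊢ s ≐ z) (sym (wk-[] s s)) (≐-refl s)))

  ≐-trans : H ⊢ s ≐ t → H ⊢ t ≐ u → H ⊢ s ≐ u
  ≐-trans {s = s} {t} {u} p q =
    subst (λ z → _ ⊢ z ≐ u) (wk-[] u s)
      (≐-subst (wk s ≐ v₀) q (subst (λ z → _ ⊢ z ≐ t) (sym (wk-[] t s)) p))

  _≐⟨_⟩_ : ∀ s → H ⊢ s ≐ t → H ⊢ t ≐ u → H ⊢ s ≐ u
  s ≐⟨ p ⟩ q = ≐-trans p q

  _≐⟨_⟨_ : ∀ s → H ⊢ t ≐ s → H ⊢ t ≐ u → H ⊢ s ≐ u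
  s ≐⟨ p ⟨ q = ≐-trans (≐-sym p) q

  _■ : ∀ s → H ⊢ s ≐ s
  s ■ = ≐-refl s

  ≈-cong : (f : Term Name Γ (σ ⟶ τ)) {s t : Term Name Γ σ} → H ⊢ s ≈ t → H ⊢ f · s ≈ f · t
  ≈-cong f p = ⇒E (ax (base (extensionality f _ _))) p

  ≈-app : {f g : Term Name Γ (σ ⟶ τ)} → H ⊢ f ≈ g → ∀ u → H ⊢ f · u ≈ g · u
  ≈-app {f = f} {g} p u =
    subst (_ ⊢_) (trans (sub-≈ (var ▸ u) (wk f · v₀) (wk g · v₀))
                        (cong₂ (λ f′ g′ → f′ · u ≈ g′ · u) (wk-[] u f) (wk-[] u g)))
          (∀E p u)

  cong₁ : (f : Term Name Γ 𝟙) → H ⊢ s ≐ t → H ⊢ f · s ≐ f · t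
  cong₁ f p = ≈-cong f p

  congˡ : (f : Term Name Γ (𝟘 ⟶ 𝟘 ⟶ 𝟘)) → H ⊢ s ≐ t → H ⊢ f · s · u ≐ f · t · u
  congˡ {u = u} f p = ≈-app (≈-cong f p) u

  congʳ : (f : Term Name Γ (𝟘 ⟶ 𝟘 ⟶ 𝟘)) → H ⊢ s ≐ t → H ⊢ f · u · s ≐ f · u · t
  congʳ f p = ≈-cong (f · _) p

  cong₂-≐ : (f : Term Name Γ (𝟘 ⟶ 𝟘 ⟶ 𝟘)) →
          H ⊢ s ≐ t → H ⊢ s′ ≐ t′ → H ⊢ f · s · s′ ≐ f · t · t′
  cong₂-≐ f p q = ≐-trans (congˡ f p) (congʳ f q)

  -- `∀I` weakens hypotheses as formulas. At an unknown type this has to be converted into the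
  -- equation between the weakened terms.
  wk-hyp : {x y : Term Name Γ σ} → H ⊢ wkᶠ {σ = τ} (x ≈ y) → H ⊢ wk x ≈ wk y
  wk-hyp {x = x} {y} = subst (_ ⊢_)
    (trans (sub-≈ ↑₁ x y) (cong₂ _≈_ (subᵗ-↑₁ x) (subᵗ-↑₁ y)))

  ∀<I : {t : Term Name Γ 𝟘} → H ⊢ ∀̇ (v₀ ≺ wk t ⇒ A) → H ⊢ ∀< t A
  ∀<I p = ⇒E (∧E₂ (∀<-def _ _)) p

  ≈-refl : (x : Term Name Γ σ) → H ⊢ x ≈ x
  ≈-refl {σ = 𝟘}     x = ≐-refl x
  ≈-refl {σ = σ ⟶ τ} x = ∀I (≈-refl (wk x · v₀))
  ≈-refl {σ = σ *}   x = ∧I (≐-refl _) (∀<I (∀I (⇒I (≈-refl (con at · wk x · v₀)))))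

  ≡⇒≈ : {x y : Term Name Γ σ} → x ≡ y → H ⊢ x ≈ y
  ≡⇒≈ refl = ≈-refl _

  ∀<E : {t : Term Name Γ 𝟘} → H ⊢ ∀< t A → ∀ i → H ⊢ i ≺ t → H ⊢ A [ i ]
  ∀<E {H = H} {t = t} p i q =
    ⇒E (∀E (⇒E (∧E₁ (∀<-def _ _)) p) i)
       (subst (λ t′ → H ⊢ i ≺ t′) (sym (wk-[] i t)) q)

  ≈-at : {x y : Term Name Γ (σ *)} → H ⊢ x ≈ y →
         ∀ i → H ⊢ i ≺ con len · x → H ⊢ con at · x · i ≈ con at · y · i
  ≈-at {x = x} {y} p i q =
    subst (_ ⊢_) (trans (sub-≈ (var ▸ i) (con at · wk x · v₀) (con at · wk y · v₀))
                        (cong₂ (λ x′ y′ → con at · x′ · i ≈ con at · y′ · i)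
                               (wk-[] i x) (wk-[] i y)))
          (∀<E (∧E₂ p) i q)

  -- An implication rather than a rule, because the recursion on the type passes under `∀I`: there
  -- hypotheses are weakened along with the context, whereas given derivations are not.
  ≈-trans⇒ : (x y z : Term Name Γ σ) → H ⊢ x ≈ y ⇒ y ≈ z ⇒ x ≈ z
  ≈-trans⇒ {σ = 𝟘} x y z = ⇒I (⇒I (≐-trans h₁ h₀))
  ≈-trans⇒ {σ = σ ⟶ τ} x y z = ⇒I (⇒I (∀I
    (⇒E (⇒E (≈-trans⇒ (wk x · v₀) (wk y · v₀) (wk z · v₀))
            (≈-app (wk-hyp {x = x} {y} h₁) v₀))
        (≈-app (wk-hyp {x = y} {z} h₀) v₀))))
  ≈-trans⇒ {σ = σ *} x y z = ⇒I (⇒I (∧I (≐-trans (∧E₁ h₁) (∧E₁ h₀)) (∀<I (∀I (⇒I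
    (⇒E (⇒E (≈-trans⇒ (con at · wk x · v₀) (con at · wk y · v₀) (con at · wk z · v₀))
            (≈-at (wk-hyp {x = x} {y} h₂) v₀ h₀))
        (≈-at (wk-hyp {x = y} {z} h₁) v₀
          -- The index is known to lie below the length of x, but the equation between y and z asks
          -- for the length of y.
          (≐-trans (congʳ monus (≐-sym (∧E₁ (wk-hyp {x = x} {y} h₂)))) h₀))))))))

  ≈-sym⇒ : (x y : Term Name Γ σ) → H ⊢ x ≈ y ⇒ y ≈ x
  ≈-sym⇒ {σ = 𝟘} x y = ⇒I (≐-sym h₀)
  ≈-sym⇒ {σ = σ ⟶ τ} x y =
    ⇒I (∀I (⇒E (≈-sym⇒ (wk x · v₀) (wk y · v₀)) (≈-app (wk-hyp {x = x} {y} h₀) v₀)))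
  ≈-sym⇒ {σ = σ *} x y = ⇒I (∧I (≐-sym (∧E₁ h₀)) (∀<I (∀I (⇒I
    (⇒E (≈-sym⇒ (con at · wk x · v₀) (con at · wk y · v₀))
        (≈-at (wk-hyp {x = x} {y} h₁) v₀
          (≐-trans (congʳ monus (∧E₁ (wk-hyp {x = x} {y} h₁))) h₀)))))))

  ≈-trans : {x y z : Term Name Γ σ} → H ⊢ x ≈ y → H ⊢ y ≈ z → H ⊢ x ≈ z
  ≈-trans {x = x} {y} {z} p q = ⇒E (⇒E (≈-trans⇒ x y z) p) q

  ≈-sym : {x y : Term Name Γ σ} → H ⊢ x ≈ y → H ⊢ y ≈ x
  ≈-sym {x = x} {y} p = ⇒E (≈-sym⇒ x y) p

  ·-cong : {f g : Term Name Γ (σ ⟶ τ)} {x y : Term Name Γ σ} →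
           H ⊢ f ≈ g → H ⊢ x ≈ y → H ⊢ f · x ≈ g · y
  ·-cong {f = f} {x = x} {y} p q = ≈-trans {y = f · y} (≈-cong f q) (≈-app p y)

  subᵗ-≈ : {s s′ : Sub Name Γ Δ} → (∀ {σ} (x : σ ∈ Γ) → H ⊢ s x ≈ s′ x) →
           (t : Term Name Γ τ) → H ⊢ subᵗ s t ≈ subᵗ s′ t
  subᵗ-≈ e (var x) = e x
  subᵗ-≈ e (con c) = ≈-refl (con c)
  subᵗ-≈ e (t · u) = ·-cong (subᵗ-≈ e t) (subᵗ-≈ e u)

  -- Correctness of bracket abstraction, and the recursor.

  data β-Spec (t : Term Name (σ ∷ Γ) τ) : Term Name Γ τ ⊎ Term Name Γ (σ ⟶ τ) → Set where
    constant : ∀ {t′} →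
      (∀ {Δ} (s : Sub Name Γ Δ) u → subᵗ s t′ ≡ subᵗ (s ▸ u) t) → β-Spec t (inj₁ t′)
    function : ∀ {t′} →
      (∀ {Δ} {H : List (Fm Name Δ)} (s : Sub Name Γ Δ) u →
        H ⊢ subᵗ s t′ · u ≈ subᵗ (s ▸ u) t) → β-Spec t (inj₂ t′)

  const′-β : (t : Term Name (σ ∷ Γ) τ) {a : Term Name Γ τ ⊎ Term Name Γ (σ ⟶ τ)} →
             β-Spec t a → (s : Sub Name Γ Δ) (u : Term Name Δ σ) →
             H ⊢ subᵗ s (const′ a) · u ≈ subᵗ (s ▸ u) t
  const′-β t (constant e) s u =
    ≈-trans (ax (base (Π-eq _ u))) (≡⇒≈ (e s u))
  const′-β t (function e) s u = e s u

  Σ-β : (t : Term Name (ρ ∷ Γ) (σ ⟶ τ)) (t′ : Term Name (ρ ∷ Γ) σ)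
        {a : Term Name Γ (σ ⟶ τ) ⊎ Term Name Γ (ρ ⟶ σ ⟶ τ)}
        {a′ : Term Name Γ σ ⊎ Term Name Γ (ρ ⟶ σ)} →
        β-Spec t a → β-Spec t′ a′ →
        β-Spec (t · t′) (inj₂ (con Σ · const′ a · const′ a′))
  Σ-β t t′ p p′ = function λ s u →
    ≈-trans (ax (base (Σ-eq _ _ u))) (·-cong (const′-β t p s u) (const′-β t′ p′ s u))

  abstr-β : (t : Term Name (σ ∷ Γ) τ) → β-Spec t (abstr t)
  abstr-β (var (here refl)) = function λ s u →
    ≈-trans (ax (base (Σ-eq (con Π) (con Π) u))) (ax (base (Π-eq u (con Π · u))))
  abstr-β (var (there x)) = constant λ s u → refl
  abstr-β (con c) = constant λ s u → refl
  abstr-β (t · t′) with abstr t | abstr t′ | abstr-β t | abstr-β t′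
  ... | inj₁ _ | inj₁ _ | constant e | constant e′ =
    constant λ s u → cong₂ _·_ (e s u) (e′ s u)
  ... | inj₁ _ | inj₂ _ | p | p′ = Σ-β t t′ p p′
  ... | inj₂ _ | inj₁ _ | p | p′ = Σ-β t t′ p p′
  ... | inj₂ _ | inj₂ _ | p | p′ = Σ-β t t′ p p′

  -- The substitution around `ƛ t` is arbitrary because applying an outer abstraction leaves one
  -- around the inner abstraction. In this form nested abstractions can be peeled off one by one.
  β : (s : Sub Name Γ Δ) (t : Term Name (σ ∷ Γ) τ) (u : Term Name Δ σ) →
      H ⊢ subᵗ s (ƛ t) · u ≈ subᵗ (s ▸ u) t
  β s t u = const′-β t (abstr-β t) s u

  ƛ-app : (s : Sub Name Γ Δ) (t : Term Name (σ ∷ Γ) τ) {f : Term Name Δ (σ ⟶ τ)} →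
          H ⊢ f ≈ subᵗ s (ƛ t) → (u : Term Name Δ σ) → H ⊢ f · u ≈ subᵗ (s ▸ u) t
  ƛ-app s t p u = ≈-trans (≈-app p u) (β s t u)

  subᵗ-var-≈ : (t : Term Name Γ σ) → H ⊢ t ≈ subᵗ var t
  subᵗ-var-≈ t = ≡⇒≈ (sym (subᵗ-var t))

  β₁ : (t : Term Name (σ ∷ Γ) τ) (u : Term Name Γ σ) →
       H ⊢ ƛ t · u ≈ subᵗ (var ▸ u) t
  β₁ t u = ƛ-app var t (subᵗ-var-≈ (ƛ t)) u

  β₂ : (t : Term Name (ρ ∷ σ ∷ Γ) τ) (u : Term Name Γ σ) (w : Term Name Γ ρ) →
       H ⊢ ƛ (ƛ t) · u · w ≈ subᵗ (var ▸ u ▸ w) t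
  β₂ t u w = ƛ-app (var ▸ u) t (β₁ (ƛ t) u) w

  β₃ : {ρ′ : Type} (t : Term Name (ρ′ ∷ ρ ∷ σ ∷ Γ) τ)
       (u : Term Name Γ σ) (w : Term Name Γ ρ) (z : Term Name Γ ρ′) →
       H ⊢ ƛ (ƛ (ƛ t)) · u · w · z ≈ subᵗ (var ▸ u ▸ w ▸ z) t
  β₃ t u w z = ƛ-app (var ▸ u ▸ w) t (β₂ (ƛ t) u w) z

  module _ (F : Term Name Δ 𝟘 → Term Name Δ 𝟘) {b : Term Name Δ 𝟘}
           (s : Sub Name Γ Δ) (e : Term Name (𝟘 ∷ 𝟘 ∷ Γ) 𝟘) {H : List (Fm Name Δ)}
           (F-rec : ∀ n → H ⊢ F n ≐ con R₀ · n · b · subᵗ s (ƛ (ƛ e))) where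

    rec-zero : H ⊢ F zer ≐ b
    rec-zero = ≐-trans (F-rec zer) (ax (base (R₀-zero _ _)))

    -- In `e` the variable `v₁` is the previous value and `v₀` the index. The axiom yields the
    -- previous value as an `R₀` term, which `r` folds back into `F n`.
    rec-suc : ∀ n → H ⊢ F (suc′ n) ≐ subᵗ (s ▸ F n ▸ n) e
    rec-suc n = ≐-trans (F-rec (suc′ n)) (≐-trans (ax (base (R₀-suc _ _ _)))
      (≈-trans (≈-app (β s (ƛ e) _) n) (≈-trans (β (s ▸ _) e n) (subᵗ-≈ r e))))
      where
      r : ∀ {σ} (x : σ ∈ _) → H ⊢ (s ▸ _ ▸ n) x ≈ (s ▸ F n ▸ n) x
      r (here refl)         = ≐-refl n
      r (there (here refl)) = ≐-sym (F-rec n)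
      r (there (there x))   = ≈-refl (s x)

  case-zero : {b : Term Name Γ 𝟘} {c : Term Name Γ (𝟘 ⟶ 𝟘 ⟶ 𝟘)} →
              H ⊢ t ≐ zer → H ⊢ con R₀ · t · b · c ≐ b
  case-zero p = ≐-trans (≈-app (≈-app (≈-cong (con R₀) p) _) _) (ax (base (R₀-zero _ _)))

  -- Serves definitions by cases: the step functions it is applied to below ignore the previous
  -- value, so that `e` is just the value in the successor case.
  case-suc : {b : Term Name Δ 𝟘} (s : Sub Name Γ Δ) (e : Term Name (𝟘 ∷ 𝟘 ∷ Γ) 𝟘) →
             H ⊢ t ≐ suc′ u →
             H ⊢ con R₀ · t · b · subᵗ s (ƛ (ƛ e)) ≐
                 subᵗ (s ▸ con R₀ · u · b · subᵗ s (ƛ (ƛ e)) ▸ u) e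
  case-suc s e p = ≐-trans (≈-app (≈-app (≈-cong (con R₀) p) _) _)
    (rec-suc (λ n → con R₀ · n · _ · subᵗ s (ƛ (ƛ e))) s e (λ n → ≐-refl _) _)

  -- Arithmetic

  v₃ : {τ₀ τ₁ τ₂ : Type} → Term N (τ₀ ∷ τ₁ ∷ τ₂ ∷ σ ∷ Γ) σ
  v₃ = var (there (there (there (here refl))))

  v₄ : {τ₀ τ₁ τ₂ τ₃ : Type} → Term N (τ₀ ∷ τ₁ ∷ τ₂ ∷ τ₃ ∷ σ ∷ Γ) σ
  v₄ = var (there (there (there (there (here refl)))))

  infixl 24 _+_ _∸_

  _+_ _∸_ : Term Name Γ 𝟘 → Term Name Γ 𝟘 → Term Name Γ 𝟘
  s + t = add · s · t
  s ∸ t = monus · s · t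

  one : Term N Γ 𝟘
  one = suc′ zer

  suc-cong : H ⊢ s ≐ t → H ⊢ suc′ s ≐ suc′ t
  suc-cong = cong₁ (con S)

  suc-injective : H ⊢ suc′ s ≐ suc′ t → H ⊢ s ≐ t
  suc-injective = ⇒E (ax (base (S-inj _ _)))

  suc≠0 : H ⊢ suc′ s ≐ zer → H ⊢ A
  suc≠0 p = exfalso (⇒E (ax (base (S≠0 _))) p)

  -- For a concrete quantifier-free formula `QuantifierFree` reduces to a product of unit types, so
  -- `qf` is inferred.
  induct : {A : Fm Name (𝟘 ∷ Γ)} {qf : QuantifierFree A} → H ⊢ A [ zer ] →
           A ∷ map wkᶠ H ⊢ sub (↑₁ ▸ suc′ v₀) A → H ⊢ ∀̇ A
  induct {A = A} {qf} p q = ⇒E (ax (base (QF-induction A qf))) (∧I p (∀I (⇒I q)))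

  add-zero : (s : Term Name Γ 𝟘) → H ⊢ s + zer ≐ s
  add-zero s = rec-zero (add · s ·_) (var ▸ s ▸ zer) (suc′ v₁)
    (β₂ (con R₀ · v₀ · v₁ · ƛ (ƛ (suc′ v₁))) s)

  add-suc : (s t : Term Name Γ 𝟘) → H ⊢ s + suc′ t ≐ suc′ (s + t)
  add-suc s t = rec-suc (add · s ·_) (var ▸ s ▸ zer) (suc′ v₁)
    (β₂ (con R₀ · v₀ · v₁ · ƛ (ƛ (suc′ v₁))) s) t

  pred-zero : {H : List (Fm Name Γ)} → H ⊢ pred′ · zer ≐ zer
  pred-zero = rec-zero (pred′ ·_) (var ▸ zer) v₀ (β₁ (con R₀ · v₀ · zer · ƛ (ƛ v₀)))

  pred-suc : (t : Term Name Γ 𝟘) → H ⊢ pred′ · suc′ t ≐ t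
  pred-suc t = rec-suc (pred′ ·_) (var ▸ zer) v₀ (β₁ (con R₀ · v₀ · zer · ƛ (ƛ v₀))) t

  monus-zero : (s : Term Name Γ 𝟘) → H ⊢ s ∸ zer ≐ s
  monus-zero s = rec-zero (monus · s ·_) (var ▸ s ▸ zer) (pred′ · v₁)
    (β₂ (con R₀ · v₀ · v₁ · ƛ (ƛ (pred′ · v₁))) s)

  monus-suc : (s t : Term Name Γ 𝟘) → H ⊢ s ∸ suc′ t ≐ pred′ · (s ∸ t)
  monus-suc s t = rec-suc (monus · s ·_) (var ▸ s ▸ zer) (pred′ · v₁)
    (β₂ (con R₀ · v₀ · v₁ · ƛ (ƛ (pred′ · v₁))) s) t

  zero-or-suc : (t : Term Name Γ 𝟘) → H ⊢ t ≐ zer ∨ t ≐ suc′ (pred′ · t)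
  zero-or-suc t = ∀E zero-or-suc′ t
    where
    zero-or-suc′ : H ⊢ ∀̇ (v₀ ≐ zer ∨ v₀ ≐ suc′ (pred′ · v₀))
    zero-or-suc′ = induct (∨I₁ (≐-refl zer)) (∨I₂ (suc-cong (≐-sym (pred-suc v₀))))

  case-nat : (t : Term Name Γ 𝟘) → (t ≐ zer) ∷ H ⊢ A → (t ≐ suc′ (pred′ · t)) ∷ H ⊢ A → H ⊢ A
  case-nat t = ∨E (zero-or-suc t)

  zero-add : (t : Term Name Γ 𝟘) → H ⊢ zer + t ≐ t
  zero-add t = ∀E zero-add′ t
    where
    zero-add′ : H ⊢ ∀̇ (zer + v₀ ≐ v₀)
    zero-add′ = induct (add-zero zer) (≐-trans (add-suc zer v₀) (suc-cong h₀))

  suc-add : (s t : Term Name Γ 𝟘) → H ⊢ suc′ s + t ≐ suc′ (s + t)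
  suc-add s t = inst₂ suc-add′ s t
    where
    suc-add′ : H ⊢ ∀̇ (∀̇ (suc′ v₁ + v₀ ≐ suc′ (v₁ + v₀)))
    suc-add′ = ∀I (induct
      (≐-trans (add-zero (suc′ v₀)) (suc-cong (≐-sym (add-zero v₀))))
      (suc′ v₁ + suc′ v₀     ≐⟨ add-suc (suc′ v₁) v₀ ⟩
       suc′ (suc′ v₁ + v₀)   ≐⟨ suc-cong h₀ ⟩
       suc′ (suc′ (v₁ + v₀)) ≐⟨ suc-cong (add-suc v₁ v₀) ⟨
       suc′ (v₁ + suc′ v₀)   ■))

  add-comm : (s t : Term Name Γ 𝟘) → H ⊢ s + t ≐ t + s
  add-comm s t = inst₂ add-comm′ s t
    where
    add-comm′ : H ⊢ ∀̇ (∀̇ (v₁ + v₀ ≐ v₀ + v₁))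
    add-comm′ = ∀I (induct
      (≐-trans (add-zero v₀) (≐-sym (zero-add v₀)))
      (v₁ + suc′ v₀   ≐⟨ add-suc v₁ v₀ ⟩
       suc′ (v₁ + v₀) ≐⟨ suc-cong h₀ ⟩
       suc′ (v₀ + v₁) ≐⟨ suc-add v₀ v₁ ⟨
       suc′ v₀ + v₁   ■))

  add-assoc : (s t u : Term Name Γ 𝟘) → H ⊢ s + t + u ≐ s + (t + u)
  add-assoc s t u = inst₃ add-assoc′ s t u
    where
    add-assoc′ : H ⊢ ∀̇ (∀̇ (∀̇ (v₂ + v₁ + v₀ ≐ v₂ + (v₁ + v₀))))
    add-assoc′ = ∀I (∀I (induct
      (≐-trans (add-zero (v₁ + v₀)) (congʳ add (≐-sym (add-zero v₀))))
      (v₂ + v₁ + suc′ v₀     ≐⟨ add-suc (v₂ + v₁) v₀ ⟩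
       suc′ (v₂ + v₁ + v₀)   ≐⟨ suc-cong h₀ ⟩
       suc′ (v₂ + (v₁ + v₀)) ≐⟨ add-suc v₂ (v₁ + v₀) ⟨
       v₂ + suc′ (v₁ + v₀)   ≐⟨ congʳ add (add-suc v₁ v₀) ⟨
       v₂ + (v₁ + suc′ v₀)   ■)))

  add-interchange : (s t u w : Term Name Γ 𝟘) → H ⊢ s + t + (u + w) ≐ s + u + (t + w)
  add-interchange s t u w =
    s + t + (u + w)   ≐⟨ add-assoc s t (u + w) ⟩
    s + (t + (u + w)) ≐⟨ congʳ add (add-assoc t u w) ⟨
    s + (t + u + w)   ≐⟨ congʳ add (congˡ add (add-comm t u)) ⟩
    s + (u + t + w)   ≐⟨ congʳ add (add-assoc u t w) ⟩
    s + (u + (t + w)) ≐⟨ add-assoc s u (t + w) ⟨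
    s + u + (t + w)   ■

  zero-monus : (t : Term Name Γ 𝟘) → H ⊢ zer ∸ t ≐ zer
  zero-monus t = ∀E zero-monus′ t
    where
    zero-monus′ : H ⊢ ∀̇ (zer ∸ v₀ ≐ zer)
    zero-monus′ = induct (monus-zero zer)
      (≐-trans (monus-suc zer v₀) (≐-trans (cong₁ pred′ h₀) pred-zero))

  suc-monus-suc : (s t : Term Name Γ 𝟘) → H ⊢ suc′ s ∸ suc′ t ≐ s ∸ t
  suc-monus-suc s t = inst₂ suc-monus-suc′ s t
    where
    suc-monus-suc′ : H ⊢ ∀̇ (∀̇ (suc′ v₁ ∸ suc′ v₀ ≐ v₁ ∸ v₀))
    suc-monus-suc′ = ∀I (induct
      (suc′ v₀ ∸ one           ≐⟨ monus-suc (suc′ v₀) zer ⟩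
       pred′ · (suc′ v₀ ∸ zer) ≐⟨ cong₁ pred′ (monus-zero (suc′ v₀)) ⟩
       pred′ · suc′ v₀         ≐⟨ pred-suc v₀ ⟩
       v₀                      ≐⟨ monus-zero v₀ ⟨
       v₀ ∸ zer                ■)
      (suc′ v₁ ∸ suc′ (suc′ v₀)   ≐⟨ monus-suc (suc′ v₁) (suc′ v₀) ⟩
       pred′ · (suc′ v₁ ∸ suc′ v₀) ≐⟨ cong₁ pred′ h₀ ⟩
       pred′ · (v₁ ∸ v₀)           ≐⟨ monus-suc v₁ v₀ ⟨
       v₁ ∸ suc′ v₀                ■))

  add-monus-cancel : (s t : Term Name Γ 𝟘) → H ⊢ s + t ∸ s ≐ t
  add-monus-cancel s t = inst₂ add-monus-cancel′ t s
    where
    add-monus-cancel′ : H ⊢ ∀̇ (∀̇ (v₀ + v₁ ∸ v₀ ≐ v₁))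
    add-monus-cancel′ = ∀I (induct
      (≐-trans (monus-zero (zer + v₀)) (zero-add v₀))
      (suc′ v₀ + v₁ ∸ suc′ v₀   ≐⟨ congˡ monus (suc-add v₀ v₁) ⟩
       suc′ (v₀ + v₁) ∸ suc′ v₀ ≐⟨ suc-monus-suc (v₀ + v₁) v₀ ⟩
       v₀ + v₁ ∸ v₀             ≐⟨ h₀ ⟩
       v₁                       ■))

  ≼-add : (s t : Term Name Γ 𝟘) → H ⊢ s ≼ s + t
  ≼-add s t = inst₂ ≼-add′ t s
    where
    ≼-add′ : H ⊢ ∀̇ (∀̇ (v₀ ≼ v₀ + v₁))
    ≼-add′ = ∀I (induct
      (zero-monus (zer + v₀))
      (≐-trans (congʳ monus (suc-add v₀ v₁)) (≐-trans (suc-monus-suc v₀ (v₀ + v₁)) h₀)))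

  add-cancelˡ : H ⊢ s + t ≐ s + u → H ⊢ t ≐ u
  add-cancelˡ {s = s} {t} {u} p =
    t         ≐⟨ add-monus-cancel s t ⟨
    s + t ∸ s ≐⟨ congˡ monus p ⟩
    s + u ∸ s ≐⟨ add-monus-cancel s u ⟩
    u         ■

  -- Comparability with the difference as an explicit term, hence quantifier-free and open to
  -- induction. The elimination rule for `_≼_` and the trichotomy `≺-connex` are read off from it.
  monus-dichotomy : (s t : Term Name Γ 𝟘) →
                    H ⊢ t + (s ∸ t) ≐ s ∨ s + (t ∸ s) ≐ t
  monus-dichotomy s t = inst₂ monus-dichotomy′ s t
    where
    monus-dichotomy′ : H ⊢ ∀̇ (∀̇ (v₀ + (v₁ ∸ v₀) ≐ v₁ ∨ v₁ + (v₀ ∸ v₁) ≐ v₀))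
    monus-dichotomy′ = ∀I (induct
      (∨I₁ (≐-trans (zero-add _) (monus-zero v₀)))
      (∨E h₀
        -- If `v₀` has caught up with `v₁`, its successor crosses over to the second alternative;
        -- otherwise the difference drops by one.
        (case-nat (v₁ ∸ v₀)
          (∨I₂ (cut (v₀             ≐⟨ add-zero v₀ ⟨
                     v₀ + zer       ≐⟨ congʳ add h₀ ⟨
                     v₀ + (v₁ ∸ v₀) ≐⟨ h₁ ⟩
                     v₁             ■)
            (v₁ + (suc′ v₀ ∸ v₁) ≐⟨ congʳ add (congˡ monus (suc-cong h₀)) ⟩
             v₁ + (suc′ v₁ ∸ v₁) ≐⟨ congʳ add (congˡ monus
                                      (≐-trans (add-suc v₁ zer) (suc-cong (add-zero v₁)))) ⟨
             v₁ + (v₁ + one ∸ v₁) ≐⟨ congʳ add (add-monus-cancel v₁ one) ⟩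
             v₁ + one            ≐⟨ add-suc v₁ zer ⟩
             suc′ (v₁ + zer)     ≐⟨ suc-cong (add-zero v₁) ⟩
             suc′ v₁             ≐⟨ suc-cong h₀ ⟨
             suc′ v₀             ■)))
          (∨I₁ (suc′ v₀ + (v₁ ∸ suc′ v₀)       ≐⟨ congʳ add (monus-suc v₁ v₀) ⟩
                suc′ v₀ + pred′ · (v₁ ∸ v₀)    ≐⟨ suc-add v₀ _ ⟩
                suc′ (v₀ + pred′ · (v₁ ∸ v₀))  ≐⟨ add-suc v₀ _ ⟨
                v₀ + suc′ (pred′ · (v₁ ∸ v₀))  ≐⟨ congʳ add h₀ ⟨
                v₀ + (v₁ ∸ v₀)                 ≐⟨ h₁ ⟩
                v₁                             ■)))
        (∨I₂ (v₁ + (suc′ v₀ ∸ v₁)               ≐⟨ congʳ add (congˡ monus (suc-cong h₀)) ⟨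
              v₁ + (suc′ (v₁ + (v₀ ∸ v₁)) ∸ v₁) ≐⟨ congʳ add (congˡ monus (add-suc v₁ _)) ⟨
              v₁ + (v₁ + suc′ (v₀ ∸ v₁) ∸ v₁)   ≐⟨ congʳ add (add-monus-cancel v₁ _) ⟩
              v₁ + suc′ (v₀ ∸ v₁)               ≐⟨ add-suc v₁ _ ⟩
              suc′ (v₁ + (v₀ ∸ v₁))             ≐⟨ suc-cong h₀ ⟩
              suc′ v₀                           ■))))

  ≼-intro : H ⊢ t ≐ s + u → H ⊢ s ≼ t
  ≼-intro {s = s} {u = u} p = ≐-trans (congʳ monus p) (≼-add s u)

  ≼-elim : H ⊢ s ≼ t → H ⊢ s + (t ∸ s) ≐ t
  ≼-elim {s = s} {t} p = cut p (∨E (monus-dichotomy s t)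
    (cut (t           ≐⟨ add-zero t ⟨
          t + zer     ≐⟨ congʳ add h₁ ⟨
          t + (s ∸ t) ≐⟨ h₀ ⟩
          s           ■)
      (s + (t ∸ s) ≐⟨ congʳ add (congˡ monus h₀) ⟩
       s + (s ∸ s) ≐⟨ congʳ add (congˡ monus (add-zero s)) ⟨
       s + (s + zer ∸ s) ≐⟨ congʳ add (add-monus-cancel s zer) ⟩
       s + zer     ≐⟨ add-zero s ⟩
       s           ≐⟨ h₀ ⟨
       t           ■))
    h₀)
  ≼-refl : (s : Term Name Γ 𝟘) → H ⊢ s ≼ s
  ≼-refl s = ≼-intro (≐-sym (add-zero s))

  ≼-trans : H ⊢ s ≼ t → H ⊢ t ≼ u → H ⊢ s ≼ u
  ≼-trans {s = s} {t} {u} p q = ≼-intro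
    (u                       ≐⟨ ≼-elim q ⟨
     t + (u ∸ t)             ≐⟨ congˡ add (≼-elim p) ⟨
     s + (t ∸ s) + (u ∸ t)   ≐⟨ add-assoc s _ _ ⟩
     s + ((t ∸ s) + (u ∸ t)) ■)

  ≼-cong : H ⊢ s ≐ s′ → H ⊢ t ≐ t′ → H ⊢ s ≼ t → H ⊢ s′ ≼ t′
  ≼-cong p q r = ≐-trans (cong₂-≐ monus (≐-sym p) (≐-sym q)) r

  ≼-suc : (s : Term Name Γ 𝟘) → H ⊢ s ≼ suc′ s
  ≼-suc s = ≼-intro (≐-sym (≐-trans (add-suc s zer) (suc-cong (add-zero s))))

  ≺⇒≼ : H ⊢ s ≺ t → H ⊢ s ≼ t
  ≺⇒≼ {s = s} = ≼-trans (≼-suc s)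

  ≼-zero : H ⊢ s ≼ zer → H ⊢ s ≐ zer
  ≼-zero {s = s} p = ≐-trans (≐-sym (monus-zero s)) p

  zero-≼ : (t : Term Name Γ 𝟘) → H ⊢ zer ≼ t
  zero-≼ = zero-monus

  suc-≼-suc : H ⊢ s ≼ t → H ⊢ suc′ s ≼ suc′ t
  suc-≼-suc {s = s} {t} = ≐-trans (suc-monus-suc s t)

  add-mono-≼ : H ⊢ s ≼ t → H ⊢ s′ ≼ t′ → H ⊢ s + s′ ≼ t + t′
  add-mono-≼ {s = s} {t} {s′ = s′} {t′} p q = ≼-intro
    (t + t′                              ≐⟨ cong₂-≐ add (≼-elim p) (≼-elim q) ⟨
     s + (t ∸ s) + (s′ + (t′ ∸ s′))      ≐⟨ add-interchange s _ s′ _ ⟩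
     s + s′ + ((t ∸ s) + (t′ ∸ s′))      ■)

  ≺-irrefl : H ⊢ s ≺ s → H ⊢ A
  ≺-irrefl {s = s} p = suc≠0 (add-cancelˡ
    (s + suc′ (s ∸ suc′ s)   ≐⟨ add-suc s _ ⟩
     suc′ (s + (s ∸ suc′ s)) ≐⟨ suc-add s _ ⟨
     suc′ s + (s ∸ suc′ s)   ≐⟨ ≼-elim p ⟩
     s                       ≐⟨ add-zero s ⟨
     s + zer                 ■))

  ≺-zero : H ⊢ s ≺ zer → H ⊢ A
  ≺-zero {s = s} p = suc≠0 (≼-zero p)

  ≼⇒≺∨≐ : H ⊢ s ≼ t → H ⊢ s ≺ t ∨ s ≐ t
  ≼⇒≺∨≐ {s = s} {t} p = cut (≼-elim p) (case-nat (t ∸ s)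
    (∨I₂ (s           ≐⟨ add-zero s ⟨
          s + zer     ≐⟨ congʳ add h₀ ⟨
          s + (t ∸ s) ≐⟨ h₁ ⟩
          t           ■))
    (∨I₁ (≼-intro
         (t                        ≐⟨ h₁ ⟨
          s + (t ∸ s)              ≐⟨ congʳ add h₀ ⟩
          s + suc′ (pred′ · (t ∸ s))   ≐⟨ add-suc s _ ⟩
          suc′ (s + pred′ · (t ∸ s)) ≐⟨ suc-add s _ ⟨
          suc′ s + pred′ · (t ∸ s) ■))))

  ≺-suc : H ⊢ s ≺ suc′ t → H ⊢ s ≺ t ∨ s ≐ t
  ≺-suc {s = s} {t} p = ≼⇒≺∨≐ (≐-trans (≐-sym (suc-monus-suc s t)) p)

  ≺-connex : (s t : Term Name Γ 𝟘) → H ⊢ s ≺ t ∨ s ≐ t ∨ t ≺ s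
  ≺-connex s t = ∨E (monus-dichotomy s t)
    (∨E (≼⇒≺∨≐ (≼-intro (≐-sym h₀))) (∨I₂ (∨I₂ h₀)) (∨I₂ (∨I₁ (≐-sym h₀))))
    (∨E (≼⇒≺∨≐ (≼-intro (≐-sym h₀))) (∨I₁ h₀) (∨I₂ (∨I₁ h₀)))

  monus-≺ : H ⊢ s ∸ t ≐ suc′ u → H ⊢ t ≺ s
  monus-≺ {s = s} {t} {u} p = cut p (∨E (monus-dichotomy s t)
    (≼-intro (s           ≐⟨ h₀ ⟨
              t + (s ∸ t) ≐⟨ congʳ add h₁ ⟩
              t + suc′ u  ≐⟨ add-suc t u ⟩
              suc′ (t + u) ≐⟨ suc-add t u ⟨
              suc′ t + u  ■))
    (suc≠0 (≐-trans (≐-sym h₁) (≼-intro (≐-sym h₀)))))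

  -- Exhibits the difference as a successor, the form that the recursion equation of `encode` and
  -- the successor cases of `trunc` and `above` ask for.
  ≺-monus : H ⊢ s ≺ t → H ⊢ t ∸ s ≐ suc′ (t ∸ suc′ s)
  ≺-monus {s = s} {t} p =
    t ∸ s                             ≐⟨ congˡ monus (≼-elim p) ⟨
    suc′ s + (t ∸ suc′ s) ∸ s         ≐⟨ congˡ monus (suc-add s _) ⟩
    suc′ (s + (t ∸ suc′ s)) ∸ s       ≐⟨ congˡ monus (add-suc s _) ⟨
    s + suc′ (t ∸ suc′ s) ∸ s         ≐⟨ add-monus-cancel s _ ⟩
    suc′ (t ∸ suc′ s)                 ■

  -- For `encode`, which reads a sequence from its last entry down: the reflection i ↦ t - 1 - i is
  -- its own inverse below t.
  monus-reflect : H ⊢ s ≺ t → H ⊢ t ∸ suc′ (t ∸ suc′ s) ≐ s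
  monus-reflect {s = s} {t} p =
    t ∸ suc′ (t ∸ suc′ s)                               ≐⟨ congˡ monus (≼-elim p) ⟨
    suc′ s + (t ∸ suc′ s) ∸ suc′ (t ∸ suc′ s)           ≐⟨ congˡ monus (suc-add s _) ⟩
    suc′ (s + (t ∸ suc′ s)) ∸ suc′ (t ∸ suc′ s)         ≐⟨ congˡ monus (suc-cong (add-comm s _)) ⟩
    suc′ ((t ∸ suc′ s) + s) ∸ suc′ (t ∸ suc′ s)         ≐⟨ suc-monus-suc _ _ ⟩
    (t ∸ suc′ s) + s ∸ (t ∸ suc′ s)                     ≐⟨ add-monus-cancel _ s ⟩
    s                                                   ■

  monus-≼ : (s t : Term Name Γ 𝟘) → H ⊢ s ∸ t ≼ s
  monus-≼ s t = ∨E (monus-dichotomy s t)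
    (≼-intro (≐-trans (≐-sym h₀) (add-comm t _)))
    (≼-cong (≐-sym (≼-intro (≐-sym h₀))) (≐-refl s) (zero-≼ s))

  tri-suc : (t : Term Name Γ 𝟘) → H ⊢ tri · suc′ t ≐ tri · t + suc′ t
  tri-suc = rec-suc (tri ·_) (var ▸ zer) (add · v₁ · suc′ v₀)
    (β₁ (con R₀ · v₀ · zer · ƛ (ƛ (add · v₁ · suc′ v₀))))

  tri-mono : (s t : Term Name Γ 𝟘) → H ⊢ tri · s ≼ tri · (s + t)
  tri-mono s t = inst₂ tri-mono′ s t
    where
    tri-mono′ : H ⊢ ∀̇ (∀̇ (tri · v₁ ≼ tri · (v₁ + v₀)))
    tri-mono′ = ∀I (induct
      (≼-cong (≐-refl _) (cong₁ tri (≐-sym (add-zero v₀))) (≼-refl _))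
      (≼-trans h₀ (≼-intro
        (≐-trans (cong₁ tri (add-suc v₁ v₀)) (tri-suc (v₁ + v₀))))))

  pair-def : (s t : Term Name Γ 𝟘) → H ⊢ pair · s · t ≐ tri · (s + t) + t
  pair-def = β₂ (add · (tri · (add · v₁ · v₀)) · v₀)

  -- A pair with sum x has a code below `tri · suc′ x`, since its second component is at most x.
  -- Hence a larger sum forces a larger code.
  pair-sum-≺ : H ⊢ s + t ≺ s′ + t′ → H ⊢ pair · s · t ≐ pair · s′ · t′ → H ⊢ A
  pair-sum-≺ {s = s} {t} {s′} {t′} p q =
    ≺-irrefl (≼-trans (≼-intro (add-cancelˡ
      (tri · x + t                       ≐⟨ pair-def s t ⟨
       pair · s · t                      ≐⟨ q ⟩
       pair · s′ · t′                    ≐⟨ pair-def s′ t′ ⟩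
       tri · y + t′                      ≐⟨ congˡ add (≼-elim tri-≼) ⟨
       tri · suc′ x + z + t′             ≐⟨ add-assoc _ z t′ ⟩
       tri · suc′ x + (z + t′)           ≐⟨ congˡ add (tri-suc x) ⟩
       tri · x + suc′ x + (z + t′)       ≐⟨ add-assoc _ _ _ ⟩
       tri · x + (suc′ x + (z + t′))     ■)))
      (≼-intro (add-comm s t)))
    where
    x = s + t
    y = s′ + t′
    z = tri · y ∸ tri · suc′ x
    tri-≼ : _ ⊢ tri · suc′ x ≼ tri · y
    tri-≼ = ≼-cong (≐-refl _) (cong₁ tri (≼-elim p)) (tri-mono (suc′ x) (y ∸ suc′ x))

  pair-sum : H ⊢ pair · s · t ≐ pair · s′ · t′ → H ⊢ s + t ≐ s′ + t′
  pair-sum {s = s} {t} {s′} {t′} p = cut p (∨E (≺-connex (s + t) (s′ + t′))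
    (pair-sum-≺ h₀ h₁)
    (∨E h₀ h₀ (pair-sum-≺ h₀ (≐-sym h₂))))

  pair-injectiveʳ : H ⊢ pair · s · t ≐ pair · s′ · t′ → H ⊢ t ≐ t′
  pair-injectiveʳ {s = s} {t} {s′} {t′} p = add-cancelˡ
    (tri · (s + t) + t    ≐⟨ pair-def s t ⟨
     pair · s · t         ≐⟨ p ⟩
     pair · s′ · t′       ≐⟨ pair-def s′ t′ ⟩
     tri · (s′ + t′) + t′ ≐⟨ congˡ add (cong₁ tri (pair-sum p)) ⟨
     tri · (s + t) + t′   ■)

  pair-injectiveˡ : H ⊢ pair · s · t ≐ pair · s′ · t′ → H ⊢ s ≐ s′
  pair-injectiveˡ {s = s} {t} {s′} {t′} p = add-cancelˡ
    (t + s    ≐⟨ add-comm t s ⟩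
     s + t    ≐⟨ pair-sum p ⟩
     s′ + t′  ≐⟨ add-comm s′ t′ ⟩
     t′ + s′  ≐⟨ congˡ add (pair-injectiveʳ p) ⟨
     t + s′   ■)

  -- Codes of initial segments.

  bar-zero : (f : Term Name Γ 𝟙) → H ⊢ bar f zer ≐ zer
  bar-zero f = rec-zero (bar f) (var ▸ f ▸ zer) (suc′ (pair · v₁ · (v₃ · v₀)))
    (β₂ (con R₀ · v₀ · zer · ƛ (ƛ (suc′ (pair · v₁ · (v₃ · v₀))))) f)

  bar-suc : (f : Term Name Γ 𝟙) (t : Term Name Γ 𝟘) →
            H ⊢ bar f (suc′ t) ≐ suc′ (pair · bar f t · (f · t))
  bar-suc f = rec-suc (bar f) (var ▸ f ▸ zer) (suc′ (pair · v₁ · (v₃ · v₀)))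
    (β₂ (con R₀ · v₀ · zer · ƛ (ƛ (suc′ (pair · v₁ · (v₃ · v₀))))) f)

  bar-suc-≐ : H ⊢ bar f (suc′ t) ≐ bar g (suc′ t) →
              H ⊢ pair · bar f t · (f · t) ≐ pair · bar g t · (g · t)
  bar-suc-≐ {f = f} {t} {g} p =
    suc-injective (≐-trans (≐-sym (bar-suc f t)) (≐-trans p (bar-suc g t)))

  -- Induction on the difference of the two lengths; injectivity of pairing strips one last entry at
  -- a time.
  bar-restrict : H ⊢ bar f t ≐ bar g t → H ⊢ s ≼ t → H ⊢ bar f s ≐ bar g s
  bar-restrict {f = f} {t} {g} {s} p q =
    ⇒E (inst₄ bar-restrict′ f g s (t ∸ s))
       (≐-trans (cong₁ (initial · f) (≼-elim q))
         (≐-trans p (cong₁ (initial · g) (≐-sym (≼-elim q)))))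
    where
    bar-restrict′ : H ⊢ ∀̇ {σ = 𝟙} (∀̇ {σ = 𝟙} (∀̇ (∀̇
      (bar v₃ (v₁ + v₀) ≐ bar v₂ (v₁ + v₀) ⇒ bar v₃ v₁ ≐ bar v₂ v₁))))
    bar-restrict′ = ∀I (∀I (∀I (induct
      (⇒I (≐-trans (cong₁ (initial · v₂) (≐-sym (add-zero v₀)))
            (≐-trans h₀ (cong₁ (initial · v₁) (add-zero v₀)))))
      (⇒I (⇒E h₁ (pair-injectiveˡ (bar-suc-≐
        (≐-trans (cong₁ (initial · v₃) (≐-sym (add-suc v₁ v₀)))
          (≐-trans h₀ (cong₁ (initial · v₂) (add-suc v₁ v₀)))))))))))

  bar-lookup : H ⊢ bar f t ≐ bar g t → H ⊢ s ≺ t → H ⊢ f · s ≐ g · s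
  bar-lookup p q = pair-injectiveʳ (bar-suc-≐ (bar-restrict p q))

  bar-agree : (f g : Term Name Γ 𝟙) (t : Term Name Γ 𝟘) →
              H ⊢ ∀̇ (v₀ ≺ wk t ⇒ wk f · v₀ ≐ wk g · v₀) → H ⊢ bar f t ≐ bar g t
  bar-agree f g t p = ⇒E (inst₃ bar-agree′ f g t) p
    where
    bar-agree′ : H ⊢ ∀̇ {σ = 𝟙} (∀̇ {σ = 𝟙} (∀̇
      (∀̇ (v₀ ≺ v₁ ⇒ v₃ · v₀ ≐ v₂ · v₀) ⇒ bar v₂ v₀ ≐ bar v₁ v₀)))
    bar-agree′ = ∀I (∀I (∀I (⇒I (⇒E (∀E below v₀) (≼-refl v₀)))))
      where
      -- The assumption of agreement contains a quantifier and may not enter the induction formula.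
      -- It is kept as a hypothesis with a fixed bound, and the induction runs over the lengths up
      -- to that bound.
      below : ∀̇ (v₀ ≺ v₁ ⇒ v₃ · v₀ ≐ v₂ · v₀) ∷ H ⊢ ∀̇ (v₀ ≼ v₁ ⇒ bar v₃ v₀ ≐ bar v₂ v₀)
      below = induct
        (⇒I (≐-trans (bar-zero v₂) (≐-sym (bar-zero v₁))))
        (⇒I (≐-trans (bar-suc v₃ v₀) (≐-trans
          (suc-cong (cong₂-≐ pair (⇒E h₁ (≺⇒≼ h₀)) (⇒E (∀E h₂ v₀) h₀)))
          (≐-sym (bar-suc v₂ v₀)))))

  -- Definable functionals

  sg : Term Name Γ 𝟙
  sg = ƛ (con R₀ · v₀ · zer · ƛ (ƛ one))

  sg-zero : H ⊢ t ≐ zer → H ⊢ sg · t ≐ zer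
  sg-zero p = ≐-trans (β₁ (con R₀ · v₀ · zer · ƛ (ƛ one)) _) (case-zero p)

  sg-suc : H ⊢ t ≐ suc′ u → H ⊢ sg · t ≐ one
  sg-suc {t = t} p = ≐-trans (β₁ (con R₀ · v₀ · zer · ƛ (ƛ one)) _) (case-suc (var ▸ t) one p)

  sg-≼-one : (t : Term Name Γ 𝟘) → H ⊢ sg · t ≼ one
  sg-≼-one t = case-nat t
    (≼-cong (≐-sym (sg-zero h₀)) (≐-refl one) (zero-≼ one))
    (≼-cong (≐-sym (sg-suc h₀)) (≐-refl one) (≼-refl one))

  sg-fixed : H ⊢ t ≼ one → H ⊢ sg · t ≐ t
  sg-fixed {t = t} p = cut p (case-nat t
    (≐-trans (sg-zero h₀) (≐-sym h₀))
    (cut (≼-zero (≐-trans (≐-sym (suc-monus-suc _ zer)) (≼-cong h₀ (≐-refl one) h₁)))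
      (≐-trans (sg-suc h₁) (≐-sym (≐-trans h₁ (suc-cong h₀))))))

  sum : Term Name Γ (𝟙 ⟶ 𝟘 ⟶ 𝟘)
  sum = ƛ (ƛ (con R₀ · v₀ · zer · ƛ (ƛ (v₁ + v₃ · v₀))))

  sum-zero : (f : Term Name Γ 𝟙) → H ⊢ sum · f · zer ≐ zer
  sum-zero f = rec-zero (sum · f ·_) (var ▸ f ▸ zer) (v₁ + v₃ · v₀)
    (β₂ (con R₀ · v₀ · zer · ƛ (ƛ (v₁ + v₃ · v₀))) f)

  sum-suc : (f : Term Name Γ 𝟙) (t : Term Name Γ 𝟘) →
            H ⊢ sum · f · suc′ t ≐ sum · f · t + f · t
  sum-suc f = rec-suc (sum · f ·_) (var ▸ f ▸ zer) (v₁ + v₃ · v₀)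
    (β₂ (con R₀ · v₀ · zer · ƛ (ƛ (v₁ + v₃ · v₀))) f)

  ≼-sum : H ⊢ s ≺ t → H ⊢ f · s ≼ sum · f · t
  ≼-sum {s = s} {t} {f} = ⇒E (inst₃ ≼-sum′ f s t)
    where
    ≼-sum′ : H ⊢ ∀̇ {σ = 𝟙} (∀̇ (∀̇ (v₁ ≺ v₀ ⇒ v₂ · v₁ ≼ sum · v₂ · v₀)))
    ≼-sum′ = ∀I (∀I (induct (⇒I (≺-zero h₀))
      (⇒I (≼-cong (≐-refl _) (≐-sym (sum-suc v₂ v₀))
        (∨E (≺-suc h₀)
          (≼-trans (⇒E h₂ h₀) (≼-add _ _))
          (≼-intro (≐-trans (congʳ add (cong₁ v₂ (≐-sym h₀))) (add-comm _ _))))))))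

  sum-of-zeros : (f : Term Name Γ 𝟙) (t : Term Name Γ 𝟘) →
                 H ⊢ ∀̇ (v₀ ≺ wk t ⇒ wk f · v₀ ≐ zer) → H ⊢ sum · f · t ≐ zer
  sum-of-zeros f t = ⇒E (inst₂ sum-of-zeros′ f t)
    where
    sum-of-zeros′ : H ⊢ ∀̇ {σ = 𝟙} (∀̇ (∀̇ (v₀ ≺ v₁ ⇒ v₂ · v₀ ≐ zer) ⇒ sum · v₁ · v₀ ≐ zer))
    sum-of-zeros′ = ∀I (∀I (⇒I (⇒E (∀E below v₀) (≼-refl v₀))))
      where
      below : ∀̇ (v₀ ≺ v₁ ⇒ v₂ · v₀ ≐ zer) ∷ H ⊢ ∀̇ (v₀ ≼ v₁ ⇒ sum · v₂ · v₀ ≐ zer)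
      below = induct (⇒I (sum-zero v₁))
        (⇒I (≐-trans (sum-suc v₂ v₀) (≐-trans
          (cong₂-≐ add (⇒E h₁ (≺⇒≼ h₀)) (⇒E (∀E h₂ v₀) h₀)) (add-zero zer))))

  -- Binary digits of numbers.

  parity half : Term Name Γ 𝟙
  parity = ƛ (con R₀ · v₀ · zer · ƛ (ƛ (one ∸ v₁)))
  half   = ƛ (con R₀ · v₀ · zer · ƛ (ƛ (v₁ + parity · v₀)))

  parity-zero : {H : List (Fm Name Γ)} → H ⊢ parity · zer ≐ zer
  parity-zero = rec-zero (parity ·_) (var ▸ zer) (one ∸ v₁)
    (β₁ (con R₀ · v₀ · zer · ƛ (ƛ (one ∸ v₁))))

  parity-suc : (t : Term Name Γ 𝟘) → H ⊢ parity · suc′ t ≐ one ∸ parity · t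
  parity-suc = rec-suc (parity ·_) (var ▸ zer) (one ∸ v₁)
    (β₁ (con R₀ · v₀ · zer · ƛ (ƛ (one ∸ v₁))))

  half-zero : {H : List (Fm Name Γ)} → H ⊢ half · zer ≐ zer
  half-zero = rec-zero (half ·_) (var ▸ zer) (v₁ + parity · v₀)
    (β₁ (con R₀ · v₀ · zer · ƛ (ƛ (v₁ + parity · v₀))))

  half-suc : (t : Term Name Γ 𝟘) → H ⊢ half · suc′ t ≐ half · t + parity · t
  half-suc = rec-suc (half ·_) (var ▸ zer) (v₁ + parity · v₀)
    (β₁ (con R₀ · v₀ · zer · ƛ (ƛ (v₁ + parity · v₀))))

  parity-≼-one : (t : Term Name Γ 𝟘) → H ⊢ parity · t ≼ one
  parity-≼-one t = case-nat t
    (≼-cong (≐-sym (≐-trans (cong₁ parity h₀) parity-zero)) (≐-refl one) (zero-≼ one))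
    (≼-cong (≐-sym (≐-trans (cong₁ parity h₀) (parity-suc _))) (≐-refl one) (monus-≼ one _))

  one-monus-zero : {H : List (Fm Name Γ)} → H ⊢ t ≐ zer → H ⊢ one ∸ t ≐ one
  one-monus-zero p = ≐-trans (congʳ monus p) (monus-zero one)

  double-suc : (t : Term Name Γ 𝟘) → H ⊢ suc′ t + suc′ t ≐ suc′ (suc′ (t + t))
  double-suc t = ≐-trans (add-suc _ t) (suc-cong (suc-add t t))

  parity-double : (t : Term Name Γ 𝟘) → H ⊢ parity · (t + t) ≐ zer
  parity-double t = ∀E parity-double′ t
    where
    parity-double′ : H ⊢ ∀̇ (parity · (v₀ + v₀) ≐ zer)
    parity-double′ = induct (≐-trans (cong₁ parity (add-zero zer)) parity-zero)
      (parity · (suc′ v₀ + suc′ v₀)         ≐⟨ cong₁ parity (double-suc v₀) ⟩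
       parity · suc′ (suc′ (v₀ + v₀))       ≐⟨ parity-suc _ ⟩
       one ∸ parity · suc′ (v₀ + v₀)        ≐⟨ congʳ monus (≐-trans (parity-suc _) (one-monus-zero h₀)) ⟩
       one ∸ one                            ≐⟨ ≼-refl one ⟩
       zer                                  ■)

  half-double : (t : Term Name Γ 𝟘) → H ⊢ half · (t + t) ≐ t
  half-double t = ∀E half-double′ t
    where
    half-double′ : H ⊢ ∀̇ (half · (v₀ + v₀) ≐ v₀)
    half-double′ = induct (≐-trans (cong₁ half (add-zero zer)) half-zero)
      (half · (suc′ v₀ + suc′ v₀)                        ≐⟨ cong₁ half (double-suc v₀) ⟩
       half · suc′ (suc′ (v₀ + v₀))                      ≐⟨ half-suc _ ⟩
       half · suc′ (v₀ + v₀) + parity · suc′ (v₀ + v₀)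
         ≐⟨ cong₂-≐ add (≐-trans (half-suc _) (cong₂-≐ add h₀ (parity-double v₀)))
                       (≐-trans (parity-suc _) (one-monus-zero (parity-double v₀))) ⟩
       v₀ + zer + one                                    ≐⟨ congˡ add (add-zero v₀) ⟩
       v₀ + one                                          ≐⟨ add-suc v₀ zer ⟩
       suc′ (v₀ + zer)                                   ≐⟨ suc-cong (add-zero v₀) ⟩
       suc′ v₀                                           ■)

  add-one : (t : Term Name Γ 𝟘) → H ⊢ t + one ≐ suc′ t
  add-one t = ≐-trans (add-suc t zer) (suc-cong (add-zero t))

  -- Together with `half-double-sg` this decodes one step of `encode`: one reads the lowest digit,
  -- the other drops it.
  parity-double-sg : (t u : Term Name Γ 𝟘) → H ⊢ parity · (t + t + sg · u) ≐ sg · u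
  parity-double-sg t u = case-nat u
    (parity · (t + t + sg · u) ≐⟨ cong₁ parity (≐-trans (congʳ add (sg-zero h₀)) (add-zero _)) ⟩
     parity · (t + t)          ≐⟨ parity-double t ⟩
     zer                       ≐⟨ sg-zero h₀ ⟨
     sg · u                    ■)
    (parity · (t + t + sg · u) ≐⟨ cong₁ parity (≐-trans (congʳ add (sg-suc h₀)) (add-one _)) ⟩
     parity · suc′ (t + t)     ≐⟨ parity-suc _ ⟩
     one ∸ parity · (t + t)    ≐⟨ one-monus-zero (parity-double t) ⟩
     one                       ≐⟨ sg-suc h₀ ⟨
     sg · u                    ■)

  half-double-sg : (t u : Term Name Γ 𝟘) → H ⊢ half · (t + t + sg · u) ≐ t
  half-double-sg t u = case-nat u
    (half · (t + t + sg · u) ≐⟨ cong₁ half (≐-trans (congʳ add (sg-zero h₀)) (add-zero _)) ⟩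
     half · (t + t)          ≐⟨ half-double t ⟩
     t                       ■)
    (half · (t + t + sg · u)           ≐⟨ cong₁ half (≐-trans (congʳ add (sg-suc h₀)) (add-one _)) ⟩
     half · suc′ (t + t)               ≐⟨ half-suc _ ⟩
     half · (t + t) + parity · (t + t) ≐⟨ cong₂-≐ add (half-double t) (parity-double t) ⟩
     t + zer                           ≐⟨ add-zero t ⟩
     t                                 ■)

  -- The quotient of s by the t-th power of 2, rounded down.
  shift : Term Name Γ (𝟘 ⟶ 𝟘 ⟶ 𝟘)
  shift = ƛ (ƛ (con R₀ · v₀ · v₁ · ƛ (ƛ (half · v₁))))

  shift-zero : (s : Term Name Γ 𝟘) → H ⊢ shift · s · zer ≐ s
  shift-zero s = rec-zero (shift · s ·_) (var ▸ s ▸ zer) (half · v₁)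
    (β₂ (con R₀ · v₀ · v₁ · ƛ (ƛ (half · v₁))) s)

  shift-suc : (s t : Term Name Γ 𝟘) → H ⊢ shift · s · suc′ t ≐ half · (shift · s · t)
  shift-suc s = rec-suc (shift · s ·_) (var ▸ s ▸ zer) (half · v₁)
    (β₂ (con R₀ · v₀ · v₁ · ƛ (ƛ (half · v₁))) s)

  -- The least significant digit comes first.
  digit : Term Name Γ (𝟘 ⟶ 𝟙)
  digit = ƛ (ƛ (parity · (shift · v₁ · v₀)))

  digit-def : (s t : Term Name Γ 𝟘) → H ⊢ digit · s · t ≐ parity · (shift · s · t)
  digit-def = β₂ (parity · (shift · v₁ · v₀))

  -- encode · f · n · j has the binary digits sg (f (n ∸ j)), …, sg (f (n ∸ 1)).
  encode : Term Name Γ (𝟙 ⟶ 𝟘 ⟶ 𝟘 ⟶ 𝟘)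
  encode = ƛ (ƛ (ƛ (con R₀ · v₀ · zer · ƛ (ƛ (v₁ + v₁ + sg · (v₄ · (v₃ ∸ suc′ v₀)))))))

  encode-zero : (f : Term Name Γ 𝟙) (s : Term Name Γ 𝟘) → H ⊢ encode · f · s · zer ≐ zer
  encode-zero f s = rec-zero (encode · f · s ·_) (var ▸ f ▸ s ▸ zer)
    (v₁ + v₁ + sg · (v₄ · (v₃ ∸ suc′ v₀)))
    (β₃ (con R₀ · v₀ · zer · ƛ (ƛ (v₁ + v₁ + sg · (v₄ · (v₃ ∸ suc′ v₀))))) f s)

  encode-suc : (f : Term Name Γ 𝟙) (s t : Term Name Γ 𝟘) →
               H ⊢ encode · f · s · suc′ t ≐
                   encode · f · s · t + encode · f · s · t + sg · (f · (s ∸ suc′ t))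
  encode-suc f s = rec-suc (encode · f · s ·_) (var ▸ f ▸ s ▸ zer)
    (v₁ + v₁ + sg · (v₄ · (v₃ ∸ suc′ v₀)))
    (β₃ (con R₀ · v₀ · zer · ƛ (ƛ (v₁ + v₁ + sg · (v₄ · (v₃ ∸ suc′ v₀))))) f s)

  -- Each step of `encode` doubles and adds a digit, so each halving undoes the latest step.
  shift-encode : H ⊢ t ≼ s →
                 H ⊢ shift · (encode · f · s · s) · t ≐ encode · f · s · (s ∸ t)
  shift-encode {t = t} {s} {f} = ⇒E (inst₃ shift-encode′ f s t)
    where
    shift-encode′ : H ⊢ ∀̇ {σ = 𝟙} (∀̇ (∀̇ (v₀ ≼ v₁ ⇒
      shift · (encode · v₂ · v₁ · v₁) · v₀ ≐ encode · v₂ · v₁ · (v₁ ∸ v₀))))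
    shift-encode′ = ∀I (∀I (induct
      (⇒I (≐-trans (shift-zero _) (cong₁ (encode · v₁ · v₀) (≐-sym (monus-zero v₀)))))
      (⇒I (
       shift · (encode · v₂ · v₁ · v₁) · suc′ v₀        ≐⟨ shift-suc _ v₀ ⟩
       half · (shift · (encode · v₂ · v₁ · v₁) · v₀)    ≐⟨ cong₁ half (⇒E h₁ (≺⇒≼ h₀)) ⟩
       half · (encode · v₂ · v₁ · (v₁ ∸ v₀))
         ≐⟨ cong₁ half (≐-trans (cong₁ (encode · v₂ · v₁) (≺-monus h₀)) (encode-suc v₂ v₁ _)) ⟩
       half · (encode · v₂ · v₁ · (v₁ ∸ suc′ v₀) + encode · v₂ · v₁ · (v₁ ∸ suc′ v₀)
               + sg · (v₂ · (v₁ ∸ suc′ (v₁ ∸ suc′ v₀))))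
         ≐⟨ half-double-sg _ _ ⟩
       encode · v₂ · v₁ · (v₁ ∸ suc′ v₀) ■))))

  digit-encode : H ⊢ t ≺ s → H ⊢ digit · (encode · f · s · s) · t ≐ sg · (f · t)
  digit-encode {t = t} {s} {f} p =
    digit · (encode · f · s · s) · t            ≐⟨ digit-def _ t ⟩
    parity · (shift · (encode · f · s · s) · t) ≐⟨ cong₁ parity (shift-encode (≺⇒≼ p)) ⟩
    parity · (encode · f · s · (s ∸ t))
      ≐⟨ cong₁ parity (≐-trans (cong₁ (encode · f · s) (≺-monus p)) (encode-suc f s _)) ⟩
    parity · (encode · f · s · (s ∸ suc′ t) + encode · f · s · (s ∸ suc′ t)
              + sg · (f · (s ∸ suc′ (s ∸ suc′ t))))
      ≐⟨ parity-double-sg _ _ ⟩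
    sg · (f · (s ∸ suc′ (s ∸ suc′ t)))          ≐⟨ cong₁ sg (cong₁ f (monus-reflect p)) ⟩
    sg · (f · t)                                ■

  -- The s-th power of 2, obtained as one more than the code whose s digits are all 1.
  bound : Term Name Γ 𝟙
  bound = ƛ (suc′ (encode · (con Π · one) · v₀ · v₀))

  -- A step of `encode` is monotone in the previous value and adds a digit of at most 1, which is
  -- the digit that the constant sequence 1 adds every time.
  encode-≺-bound : (f : Term Name Γ 𝟙) (s : Term Name Γ 𝟘) →
                   H ⊢ encode · f · s · s ≺ bound · s
  encode-≺-bound f s = ≼-cong (≐-refl _)
    (≐-sym (β₁ (suc′ (encode · (con Π · one) · v₀ · v₀)) s))
    (suc-≼-suc (inst₃ encode-≼ f s s))
    where
    encode-≼ : H ⊢ ∀̇ {σ = 𝟙} (∀̇ (∀̇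
      (encode · v₂ · v₁ · v₀ ≼ encode · (con Π · one) · v₁ · v₀)))
    encode-≼ = ∀I (∀I (induct
      (≼-cong (≐-sym (encode-zero v₁ v₀)) (≐-refl _) (zero-≼ _))
      (≼-cong (≐-sym (encode-suc v₂ v₁ v₀)) (≐-sym (encode-suc (con Π · one) v₁ v₀))
        (add-mono-≼ (add-mono-≼ h₀ h₀)
          (≼-cong (≐-refl _) (≐-sym (sg-suc (ax (base (Π-eq one _))))) (sg-≼-one _))))))

  -- Truncation, blending, and the search for the least modulus.

  trunc : Term Name Γ (𝟘 ⟶ 𝟙 ⟶ 𝟙)
  trunc = ƛ (ƛ (ƛ (con R₀ · (v₂ ∸ v₀) · zer · ƛ (ƛ (v₃ · v₂)))))

  trunc-≽ : H ⊢ s ∸ t ≐ zer → H ⊢ trunc · s · f · t ≐ zer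
  trunc-≽ {s = s} {t} {f} p =
    ≐-trans (β₃ (con R₀ · (v₂ ∸ v₀) · zer · ƛ (ƛ (v₃ · v₂))) s f t) (case-zero p)

  trunc-≺ : H ⊢ s ∸ t ≐ suc′ u → H ⊢ trunc · s · f · t ≐ f · t
  trunc-≺ {s = s} {t} {f = f} p =
    ≐-trans (β₃ (con R₀ · (v₂ ∸ v₀) · zer · ƛ (ƛ (v₃ · v₂))) s f t)
            (case-suc (var ▸ s ▸ f ▸ t) (v₃ · v₂) p)

  blend : Term Name Γ (𝟙 ⟶ 𝟙 ⟶ 𝟙)
  blend = ƛ (ƛ (ƛ (con R₀ · (v₁ · v₀) · (v₂ · v₀) · ƛ (ƛ (sg · (v₄ · v₂))))))

  blend-zero : H ⊢ g · t ≐ zer → H ⊢ blend · f · g · t ≐ f · t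
  blend-zero {g = g} {t} {f} p =
    ≐-trans (β₃ (con R₀ · (v₁ · v₀) · (v₂ · v₀) · ƛ (ƛ (sg · (v₄ · v₂)))) f g t) (case-zero p)

  blend-suc : H ⊢ g · t ≐ suc′ u → H ⊢ blend · f · g · t ≐ sg · (f · t)
  blend-suc {g = g} {t} {f = f} p =
    ≐-trans (β₃ (con R₀ · (v₁ · v₀) · (v₂ · v₀) · ƛ (ƛ (sg · (v₄ · v₂)))) f g t)
            (case-suc (var ▸ f ▸ g ▸ t) (sg · (v₄ · v₂)) p)

  -- The absolute difference: it turns equations into numbers, which can be summed over a bounded
  -- range.
  dist : Term Name Γ (𝟘 ⟶ 𝟘 ⟶ 𝟘)
  dist = ƛ (ƛ ((v₁ ∸ v₀) + (v₀ ∸ v₁)))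

  dist-≐ : H ⊢ s ≐ t → H ⊢ dist · s · t ≐ zer
  dist-≐ {s = s} {t} p =
    ≐-trans (β₂ ((v₁ ∸ v₀) + (v₀ ∸ v₁)) s t)
      (≐-trans (cong₂-≐ add (≼-cong (≐-refl s) p (≼-refl s)) (≼-cong p (≐-refl s) (≼-refl s)))
               (add-zero zer))

  dist-zero : H ⊢ dist · s · t ≐ zer → H ⊢ s ≐ t
  dist-zero {s = s} {t} p = cut (≐-trans (≐-sym (β₂ ((v₁ ∸ v₀) + (v₀ ∸ v₁)) s t)) p)
    (s           ≐⟨ add-zero s ⟨
     s + zer     ≐⟨ congʳ add (≼-zero (≼-intro (≐-trans (≐-sym h₀) (add-comm _ _)))) ⟨
     s + (t ∸ s) ≐⟨ ≼-elim (≼-zero (≼-intro (≐-sym h₀))) ⟩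
     t           ■)

  -- r is a modulus of φ on the digit sequences iff φ is unchanged when they are cut off at r.
  defect : Term Name Γ (𝟚 ⟶ 𝟘 ⟶ 𝟙)
  defect = ƛ (ƛ (ƛ (dist · (v₂ · (digit · v₀)) · (v₂ · (trunc · v₁ · (digit · v₀))))))

  defect-def : (f : Term Name Γ 𝟚) (s t : Term Name Γ 𝟘) →
               H ⊢ defect · f · s · t ≐
                   dist · (f · (digit · t)) · (f · (trunc · s · (digit · t)))
  defect-def = β₃ (dist · (v₂ · (digit · v₀)) · (v₂ · (trunc · v₁ · (digit · v₀))))

  -- A bounded universal quantifier as a sum over the codes below `v₁`: it vanishes iff the
  -- candidate modulus `v₀` passes the test on all of them.
  defects : Term Name Γ (𝟚 ⟶ 𝟘 ⟶ 𝟙)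
  defects = ƛ (ƛ (ƛ (sum · (defect · v₂ · v₀) · v₁)))

  defects-def : (f : Term Name Γ 𝟚) (s t : Term Name Γ 𝟘) →
                H ⊢ defects · f · s · t ≐ sum · (defect · f · t) · s
  defects-def = β₃ (sum · (defect · v₂ · v₀) · v₁)

  -- Counts upwards for as long as there are defects, so it stops at the least number without any.
  least : Term Name Γ (𝟚 ⟶ 𝟘 ⟶ 𝟘 ⟶ 𝟘)
  least = ƛ (ƛ (ƛ (con R₀ · v₀ · zer · ƛ (ƛ (v₁ + sg · (defects · v₄ · v₃ · v₁))))))

  least-zero : (f : Term Name Γ 𝟚) (s : Term Name Γ 𝟘) → H ⊢ least · f · s · zer ≐ zer
  least-zero f s = rec-zero (least · f · s ·_) (var ▸ f ▸ s ▸ zer)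
    (v₁ + sg · (defects · v₄ · v₃ · v₁))
    (β₃ (con R₀ · v₀ · zer · ƛ (ƛ (v₁ + sg · (defects · v₄ · v₃ · v₁)))) f s)

  least-suc : (f : Term Name Γ 𝟚) (s t : Term Name Γ 𝟘) →
              H ⊢ least · f · s · suc′ t ≐
                  least · f · s · t + sg · (defects · f · s · (least · f · s · t))
  least-suc f s = rec-suc (least · f · s ·_) (var ▸ f ▸ s ▸ zer)
    (v₁ + sg · (defects · v₄ · v₃ · v₁))
    (β₃ (con R₀ · v₀ · zer · ƛ (ƛ (v₁ + sg · (defects · v₄ · v₃ · v₁)))) f s)

  least-≼ : (f : Term Name Γ 𝟚) (s t : Term Name Γ 𝟘) → H ⊢ least · f · s · t ≼ t
  least-≼ f s t = inst₃ least-≼′ f s t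
    where
    least-≼′ : H ⊢ ∀̇ {σ = 𝟚} (∀̇ (∀̇ (least · v₂ · v₁ · v₀ ≼ v₀)))
    least-≼′ = ∀I (∀I (induct
      (≼-cong (≐-sym (least-zero v₁ v₀)) (≐-refl zer) (≼-refl zer))
      (≼-cong (≐-sym (least-suc v₂ v₁ v₀)) (add-one v₀)
        (add-mono-≼ h₀ (sg-≼-one _)))))

  -- The counter starts at zero and moves by at most one per step, so it cannot jump over u; and at
  -- u it stops, since there are no defects there.
  least-minimal : H ⊢ defects · f · s · u ≐ zer → H ⊢ least · f · s · t ≼ u
  least-minimal {f = f} {s} {u} {t} = ⇒E (inst₄ least-minimal′ f s u t)
    where
    least-minimal′ : H ⊢ ∀̇ {σ = 𝟚} (∀̇ (∀̇ (∀̇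
      (defects · v₃ · v₂ · v₁ ≐ zer ⇒ least · v₃ · v₂ · v₀ ≼ v₁))))
    least-minimal′ = ∀I (∀I (∀I (induct
      (⇒I (≼-cong (≐-sym (least-zero v₂ v₁)) (≐-refl v₀) (zero-≼ v₀)))
      (⇒I (≼-cong (≐-sym (least-suc v₃ v₂ v₀)) (≐-refl v₁)
        (∨E (≼⇒≺∨≐ (⇒E h₁ h₀))
          (≼-trans (add-mono-≼ (≼-refl _) (sg-≼-one _))
            (≼-cong (≐-sym (add-one _)) (≐-refl v₁) h₀))
          (≼-cong (≐-sym (≐-trans (congʳ add (sg-zero (≐-trans (cong₁ (defects · _ · _) h₀) h₁)))
                                  (add-zero _)))
                  (≐-refl v₁) (≼-intro (≐-sym (≐-trans (add-zero _) h₀))))))))))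

  -- The counter either has stopped, which happens only where there are no defects, or has moved at
  -- every one of the t steps.
  least-sound : (f : Term Name Γ 𝟚) (s t : Term Name Γ 𝟘) →
                H ⊢ defects · f · s · (least · f · s · t) ≐ zer
                    ∨ least · f · s · t ≐ t
  least-sound f s t = inst₃ least-sound′ f s t
    where
    least-sound′ : H ⊢ ∀̇ {σ = 𝟚} (∀̇ (∀̇
      (defects · v₂ · v₁ · (least · v₂ · v₁ · v₀) ≐ zer ∨ least · v₂ · v₁ · v₀ ≐ v₀)))
    least-sound′ = ∀I (∀I (induct
      (∨I₂ (least-zero v₁ v₀))
      (case-nat (defects · v₂ · v₁ · (least · v₂ · v₁ · v₀))
        (∨I₁ (≐-trans (cong₁ (defects · _ · _) (≐-trans (least-suc v₂ v₁ v₀)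
                        (≐-trans (congʳ add (sg-zero h₀)) (add-zero _)))) h₀))
        (∨E h₁ (suc≠0 (≐-trans (≐-sym h₁) h₀))
          (∨I₂ (≐-trans (least-suc v₂ v₁ v₀)
            (≐-trans (cong₂-≐ add h₀ (sg-suc h₁)) (add-one v₀))))))))

  -- Standardness and moduli

  Binaryˢᵗ : Term Name Γ 𝟙 → Fm Name Γ
  Binaryˢᵗ f = (Binary f) ˢᵗ

  IsModulusˢᵗ : Term Name Γ 𝟚 → Term Name Γ 𝟘 → Fm Name Γ
  IsModulusˢᵗ φ t = (IsModulus φ t) ˢᵗ

  closed-st : (t : Term Name [] σ) → H ⊢ st (fromClosedᵗ t)
  closed-st t = ax (st-closed t)

  app-st : H ⊢ st f → H ⊢ st t → H ⊢ st (f · t)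
  app-st p q = ⇒E (⇒E (ax (st-app _ _)) p) q

  ≼-st : H ⊢ s ≼ t → H ⊢ st t → H ⊢ st s
  ≼-st p q = ⇒E (⇒E (ax (st-≼ _ _)) p) q

  binaryˢᵗ-at : (f : Term Name Γ 𝟙) → H ⊢ Binaryˢᵗ f → ∀ t → H ⊢ st t → H ⊢ f · t ≼ one
  binaryˢᵗ-at f p t q = ⇒E (⇒E (inst₂ binaryˢᵗ-at′ f t) p) q
    where
    binaryˢᵗ-at′ : H ⊢ ∀̇ (∀̇ (Binaryˢᵗ v₁ ⇒ st v₀ ⇒ v₁ · v₀ ≼ one))
    binaryˢᵗ-at′ = ∀I (∀I (⇒I (∀E h₀ v₀)))

  binary⇒binaryˢᵗ : (f : Term Name Γ 𝟙) → H ⊢ Binary f → H ⊢ Binaryˢᵗ f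
  binary⇒binaryˢᵗ f p = ⇒E (∀E binary⇒binaryˢᵗ′ f) p
    where
    binary⇒binaryˢᵗ′ : H ⊢ ∀̇ (Binary v₀ ⇒ Binaryˢᵗ v₀)
    binary⇒binaryˢᵗ′ = ∀I (⇒I (∀I (⇒I (∀E h₁ v₀))))

  modulus : (φ : Term Name Γ 𝟚) (t : Term Name Γ 𝟘) (f g : Term Name Γ 𝟙) →
            H ⊢ IsModulus φ t → H ⊢ Binary f → H ⊢ Binary g →
            H ⊢ bar f t ≐ bar g t → H ⊢ φ · f ≐ φ · g
  modulus φ t f g m p q r = ⇒E (⇒E (⇒E (inst₄ modulus′ φ t f g) m) (∧I p q)) r
    where
    modulus′ : H ⊢ ∀̇ (∀̇ (∀̇ (∀̇
      (IsModulus v₃ v₂ ⇒ Binary v₁ ∧ Binary v₀ ⇒ bar v₁ v₂ ≐ bar v₀ v₂ ⇒ v₃ · v₁ ≐ v₃ · v₀))))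
    modulus′ = ∀I (∀I (∀I (∀I (⇒I (∀E (∀E h₀ v₁) v₀)))))

  modulusˢᵗ : (φ : Term Name Γ 𝟚) (t : Term Name Γ 𝟘) (f g : Term Name Γ 𝟙) →
              H ⊢ IsModulusˢᵗ φ t → H ⊢ st f → H ⊢ st g →
              H ⊢ Binaryˢᵗ f → H ⊢ Binaryˢᵗ g →
              H ⊢ bar f t ≐ bar g t → H ⊢ φ · f ≐ φ · g
  modulusˢᵗ φ t f g m sf sg p q r =
    ⇒E (⇒E (⇒E (⇒E (⇒E (inst₄ modulusˢᵗ′ φ t f g) m) sf) sg) (∧I p q)) r
    where
    modulusˢᵗ′ : H ⊢ ∀̇ (∀̇ (∀̇ (∀̇
      (IsModulusˢᵗ v₃ v₂ ⇒ st v₁ ⇒ st v₀ ⇒ Binaryˢᵗ v₁ ∧ Binaryˢᵗ v₀ ⇒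
       bar v₁ v₂ ≐ bar v₀ v₂ ⇒ v₃ · v₁ ≐ v₃ · v₀))))
    modulusˢᵗ′ = ∀I (∀I (∀I (∀I (⇒I (⇒I (⇒I
      (⇒E (∀E (⇒E (∀E h₂ v₁) h₁) v₀) h₀)))))))

  sg-binaryˢᵗ : (f : Term Name Γ 𝟙) (t : Term Name Γ 𝟘) →
                H ⊢ Binaryˢᵗ f → H ⊢ st t → H ⊢ sg · (f · t) ≐ f · t
  sg-binaryˢᵗ f t p q = sg-fixed (binaryˢᵗ-at f p t q)

  binary-digit : (t : Term Name Γ 𝟘) → H ⊢ Binary (digit · t)
  binary-digit t = ∀E binary-digit′ t
    where
    binary-digit′ : H ⊢ ∀̇ (Binary (digit · v₀))
    binary-digit′ = ∀I (∀I (≼-cong (≐-sym (digit-def v₁ v₀)) (≐-refl one) (parity-≼-one _)))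

  binary-trunc : (t : Term Name Γ 𝟘) (f : Term Name Γ 𝟙) →
                 H ⊢ Binary f → H ⊢ Binary (trunc · t · f)
  binary-trunc t f p = ⇒E (inst₂ binary-trunc′ t f) p
    where
    binary-trunc′ : H ⊢ ∀̇ (∀̇ (Binary v₀ ⇒ Binary (trunc · v₁ · v₀)))
    binary-trunc′ = ∀I (∀I (⇒I (∀I (case-nat (v₂ ∸ v₀)
      (≼-cong (≐-sym (trunc-≽ h₀)) (≐-refl one) (zero-≼ one))
      (≼-cong (≐-sym (trunc-≺ h₀)) (≐-refl one) (∀E h₁ v₀))))))

  bar-trunc : (f : Term Name Γ 𝟙) (t : Term Name Γ 𝟘) → H ⊢ bar f t ≐ bar (trunc · t · f) t
  bar-trunc f t = inst₂ bar-trunc′ f t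
    where
    bar-trunc′ : H ⊢ ∀̇ (∀̇ (bar v₁ v₀ ≐ bar (trunc · v₀ · v₁) v₀))
    bar-trunc′ = ∀I (∀I (bar-agree v₁ (trunc · v₀ · v₁) v₀
      (∀I (⇒I (≐-sym (trunc-≺ (≺-monus h₀)))))))

  -- The truncations are equal as functions, not only up to t, so by extensionality every functional
  -- takes the same value on them.
  trunc-agree : (t : Term Name Γ 𝟘) (f g : Term Name Γ 𝟙) →
                H ⊢ ∀̇ (v₀ ≺ wk t ⇒ wk f · v₀ ≐ wk g · v₀) → H ⊢ trunc · t · f ≈ trunc · t · g
  trunc-agree t f g p = ⇒E (inst₃ trunc-agree′ t f g) p
    where
    trunc-agree′ : H ⊢ ∀̇ (∀̇ (∀̇ (∀̇ (v₀ ≺ v₃ ⇒ v₂ · v₀ ≐ v₁ · v₀) ⇒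
      trunc · v₂ · v₁ ≈ trunc · v₂ · v₀)))
    trunc-agree′ = ∀I (∀I (∀I (⇒I (∀I (case-nat (v₃ ∸ v₀)
      (≐-trans (trunc-≽ h₀) (≐-sym (trunc-≽ h₀)))
      (≐-trans (trunc-≺ h₀) (≐-trans (⇒E (∀E h₁ v₀) (monus-≺ h₀)) (≐-sym (trunc-≺ h₀)))))))))

  -- Codes below the standard number s are standard, hence so are their digit sequences and the
  -- truncations of these at t. A modulus for standard sequences therefore applies to every test.
  modulusˢᵗ-defects : (φ : Term Name Γ 𝟚) (s t : Term Name Γ 𝟘) →
                      H ⊢ IsModulusˢᵗ φ t → H ⊢ st t → H ⊢ st s →
                      H ⊢ defects · φ · s · t ≐ zer
  modulusˢᵗ-defects φ s t p q r = ⇒E (⇒E (⇒E (inst₃ modulusˢᵗ-defects′ φ s t) p) q) r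
    where
    no-defect : st v₀ ∷ v₀ ≺ v₂ ∷ st v₂ ∷ st v₁ ∷ IsModulusˢᵗ v₃ v₁ ∷ H ⊢
                v₃ · (digit · v₀) ≐ v₃ · (trunc · v₁ · (digit · v₀))
    no-defect = cut (app-st (closed-st digit) h₀)
      (modulusˢᵗ v₃ v₁ (digit · v₀) (trunc · v₁ · (digit · v₀)) h₅ h₀
        (app-st (app-st (closed-st trunc) h₄) h₀)
        (binary⇒binaryˢᵗ (digit · v₀) (binary-digit v₀))
        (binary⇒binaryˢᵗ (trunc · v₁ · (digit · v₀))
                         (binary-trunc v₁ (digit · v₀) (binary-digit v₀)))
        (bar-trunc (digit · v₀) v₁))
    modulusˢᵗ-defects′ : H ⊢ ∀̇ (∀̇ (∀̇
      (IsModulusˢᵗ v₂ v₀ ⇒ st v₀ ⇒ st v₁ ⇒ defects · v₂ · v₁ · v₀ ≐ zer)))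
    modulusˢᵗ-defects′ = ∀I (∀I (∀I (⇒I (⇒I (⇒I (≐-trans (defects-def v₂ v₁ v₀)
      (sum-of-zeros (defect · v₂ · v₀) v₁ (∀I (⇒I (≐-trans (defect-def v₃ v₁ v₀) (dist-≐
        (cut (≼-st (≺⇒≼ h₀) h₁) no-defect))))))))))))

  -- The digit sequence agrees with f below t: indices there are standard, so f has values 0 or 1
  -- and `sg` leaves them unchanged.
  encoded : (φ : Term Name Γ 𝟚) (f : Term Name Γ 𝟙) (t : Term Name Γ 𝟘) →
            H ⊢ IsModulusˢᵗ φ t → H ⊢ st t → H ⊢ st f → H ⊢ Binaryˢᵗ f →
            H ⊢ φ · f ≐ φ · (digit · (encode · f · t · t))
  encoded φ f t p q r b = ⇒E (⇒E (⇒E (⇒E (inst₃ encoded′ φ f t) p) q) r) b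
    where
    encoded′ : H ⊢ ∀̇ (∀̇ (∀̇ (IsModulusˢᵗ v₂ v₀ ⇒ st v₀ ⇒ st v₁ ⇒ Binaryˢᵗ v₁ ⇒
      v₂ · v₁ ≐ v₂ · (digit · (encode · v₁ · v₀ · v₀)))))
    encoded′ = ∀I (∀I (∀I (⇒I (⇒I (⇒I (⇒I
      (modulusˢᵗ v₂ v₀ v₁ (digit · (encode · v₁ · v₀ · v₀)) h₃ h₁
        (app-st (closed-st digit) (app-st (app-st (app-st (closed-st encode) h₁) h₂) h₂))
        h₀ (binary⇒binaryˢᵗ (digit · (encode · v₁ · v₀ · v₀)) (binary-digit (encode · v₁ · v₀ · v₀)))
        (bar-agree v₁ (digit · (encode · v₁ · v₀ · v₀)) v₀
          (∀I (⇒I (≐-sym (≐-trans (digit-encode h₀)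
            (sg-binaryˢᵗ v₂ v₀ h₁ (≼-st (≺⇒≼ h₀) h₃))))))))))))))

  -- A summand is at most the sum, which vanishes here.
  no-defect : (φ : Term Name Γ 𝟚) (r t u : Term Name Γ 𝟘) →
              H ⊢ defects · φ · r · t ≐ zer → H ⊢ u ≺ r →
              H ⊢ φ · (digit · u) ≐ φ · (trunc · t · (digit · u))
  no-defect φ r t u p q = dist-zero (≐-trans (≐-sym (defect-def φ t u))
    (≼-zero (≼-cong (≐-refl _) (≐-trans (≐-sym (defects-def φ r t)) p) (≼-sum q))))

  -- The known modulus t replaces both sequences by digit sequences of codes below `bound · t`. On
  -- these, absence of defects allows truncation at s, and the truncations coincide when the
  -- sequences agree below s.
  restrict-modulusˢᵗ : (φ : Term Name Γ 𝟚) (s t : Term Name Γ 𝟘) →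
                       H ⊢ IsModulusˢᵗ φ t → H ⊢ st t → H ⊢ s ≼ t →
                       H ⊢ defects · φ · (bound · t) · s ≐ zer → H ⊢ IsModulusˢᵗ φ s
  restrict-modulusˢᵗ φ s t p q r d =
    ⇒E (⇒E (⇒E (⇒E (inst₃ restrict-modulusˢᵗ′ φ t s) p) q) r) d
    where
    restrict-modulusˢᵗ′ : H ⊢ ∀̇ (∀̇ (∀̇ (IsModulusˢᵗ v₂ v₁ ⇒ st v₁ ⇒ v₀ ≼ v₁ ⇒
      defects · v₂ · (bound · v₁) · v₀ ≐ zer ⇒ IsModulusˢᵗ v₂ v₀)))
    restrict-modulusˢᵗ′ = ∀I (∀I (∀I (⇒I (⇒I (⇒I (⇒I (∀I (⇒I (∀I (⇒I (⇒I (⇒I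
      (v₄ · v₁ ≐⟨ encoded v₄ v₁ v₃ h₇ h₆ h₃ (∧E₁ h₁) ⟩
       v₄ · (digit · (encode · v₁ · v₃ · v₃))
         ≐⟨ no-defect v₄ (bound · v₃) v₂ (encode · v₁ · v₃ · v₃) h₄ (encode-≺-bound v₁ v₃) ⟩
       v₄ · (trunc · v₂ · (digit · (encode · v₁ · v₃ · v₃)))
         ≐⟨ ≈-cong v₄ (trunc-agree v₂ (digit · (encode · v₁ · v₃ · v₃)) (digit · (encode · v₀ · v₃ · v₃))
              -- `encode` is faithful only below t, so s ≼ t is used to cover the indices below s.
              (∀I (⇒I (cut (≼-trans h₀ h₆)
                (≐-trans (digit-encode h₀)
                  (≐-trans (cong₁ sg (bar-lookup h₂ h₁)) (≐-sym (digit-encode h₀)))))))) ⟩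
       v₄ · (trunc · v₂ · (digit · (encode · v₀ · v₃ · v₃)))
         ≐⟨ no-defect v₄ (bound · v₃) v₂ (encode · v₀ · v₃ · v₃) h₄ (encode-≺-bound v₀ v₃) ⟨
       v₄ · (digit · (encode · v₀ · v₃ · v₃))
         ≐⟨ encoded v₄ v₀ v₃ h₇ h₆ h₂ (∧E₂ h₁) ⟨
       v₄ · v₀ ■)))))))))))))

  -- The three implications

  MUC⇒𝔓 : H ⊢ MUC ⇒ 𝔓
  MUC⇒𝔓 = ⇒I (∃E fan
    (∀I (⇒I (∃I (v₁ · v₀) (∧I (app-st (∧E₁ h₁) h₀) (∀E (∧E₂ h₁) v₀))))))
    where
    fan : MUC ∷ H ⊢ ∃ˢᵗ {σ = 𝟛} (∀̇ {σ = 𝟚} (IsModulus v₀ (v₁ · v₀)))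
    fan = raa (∃E h₁ (⇒E (∀E (⇒E
      -- Transfer of the parameter-free negation: if no standard functional were a fan functional,
      -- none would be.
      (ax (PF-TP∀ (¬̇ ∀̇ {σ = 𝟚} (IsModulus v₀ (v₁ · v₀))) _))
      (∀I (⇒I (⇒I (⇒E h₃ (∃I v₀ (∧I h₁ h₀))))))) v₀) h₀))

  -- From `𝔓` to a fan functional on standard sequences.

  above : Term Name Γ (𝟘 ⟶ 𝟙)
  above = ƛ (ƛ (one ∸ (v₁ ∸ v₀)))

  above-def : (s t : Term Name Γ 𝟘) → H ⊢ above · s · t ≐ one ∸ (s ∸ t)
  above-def = β₂ (one ∸ (v₁ ∸ v₀))

  above-≺ : (s t : Term Name Γ 𝟘) → H ⊢ s ∸ t ≐ suc′ u → H ⊢ above · s · t ≐ zer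
  above-≺ s t p = ≐-trans (above-def s t) (≐-trans (congʳ monus p)
    (≐-trans (suc-monus-suc zer _) (zero-monus _)))

  above-≽ : (s t : Term Name Γ 𝟘) → H ⊢ s ∸ t ≐ zer → H ⊢ above · s · t ≐ one
  above-≽ s t p = ≐-trans (above-def s t) (one-monus-zero p)

  sgs : Term Name Γ (𝟙 ⟶ 𝟙)
  sgs = ƛ (ƛ (sg · (v₁ · v₀)))

  sgs-def : (f : Term Name Γ 𝟙) (t : Term Name Γ 𝟘) → H ⊢ sgs · f · t ≐ sg · (f · t)
  sgs-def = β₂ (sg · (v₁ · v₀))

  binary-sgs : (f : Term Name Γ 𝟙) → H ⊢ Binary (sgs · f)
  binary-sgs f = ∀E binary-sgs′ f
    where
    binary-sgs′ : H ⊢ ∀̇ {σ = 𝟙} (Binary (sgs · v₀))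
    binary-sgs′ = ∀I (∀I (≼-cong (≐-sym (sgs-def v₁ v₀)) (≐-refl one) (sg-≼-one _)))

  bar-sgs : (f g : Term Name Γ 𝟙) (t : Term Name Γ 𝟘) →
            H ⊢ bar f t ≐ bar g t → H ⊢ bar (sgs · f) t ≐ bar (sgs · g) t
  bar-sgs f g t = ⇒E (inst₃ bar-sgs′ f g t)
    where
    bar-sgs′ : H ⊢ ∀̇ {σ = 𝟙} (∀̇ {σ = 𝟙} (∀̇
      (bar v₂ v₀ ≐ bar v₁ v₀ ⇒ bar (sgs · v₂) v₀ ≐ bar (sgs · v₁) v₀)))
    bar-sgs′ = ∀I (∀I (∀I (⇒I (bar-agree (sgs · v₂) (sgs · v₁) v₀ (∀I (⇒I
      (≐-trans (sgs-def v₃ v₀) (≐-trans (cong₁ sg (bar-lookup h₁ h₀)) (≐-sym (sgs-def v₂ v₀))))))))))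

  precompose-blend : Term Name Γ (𝟚 ⟶ 𝟙 ⟶ 𝟚)
  precompose-blend = ƛ (ƛ (ƛ (v₂ · (blend · v₁ · v₀))))

  precompose-blend-def : (φ : Term Name Γ 𝟚) (f g : Term Name Γ 𝟙) →
                         H ⊢ precompose-blend · φ · f · g ≐ φ · (blend · f · g)
  precompose-blend-def = β₃ (v₂ · (blend · v₁ · v₀))

  -- `𝔓` cannot be applied to f directly, as f may have other values at nonstandard arguments. It is
  -- applied to the selector in `blend` instead, for which two sequences that are 0-1 valued
  -- everywhere are compared.
  sgs-invariant : (φ : Term Name Γ 𝟚) (f : Term Name Γ 𝟙) → H ⊢ 𝔓 →
                  H ⊢ st φ → H ⊢ st f → H ⊢ Binaryˢᵗ f → H ⊢ φ · f ≐ φ · (sgs · f)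
  sgs-invariant φ f p q r b = ⇒E (⇒E (⇒E (⇒E (inst₂ sgs-invariant′ φ f) p) q) r) b
    where
    zeros : Term Name Γ 𝟙
    zeros = con Π · zer
    binary-zeros : {H : List (Fm Name Γ)} → H ⊢ Binary zeros
    binary-zeros = ∀I (≼-cong (≐-sym (ax (base (Π-eq zer v₀)))) (≐-refl one) (zero-≼ one))
    binary-above : {H : List (Fm Name (𝟘 ∷ Γ))} → H ⊢ Binary (above · v₀)
    binary-above = ∀I (≼-cong (≐-sym (above-def v₁ v₀)) (≐-refl one) (monus-≼ one _))
    bar-above : {H : List (Fm Name (𝟘 ∷ Γ))} → H ⊢ bar zeros v₀ ≐ bar (above · v₀) v₀
    bar-above = bar-agree zeros (above · v₀) v₀ (∀I (⇒I
      (≐-trans (ax (base (Π-eq zer v₀))) (≐-sym (above-≺ v₁ v₀ (≺-monus h₀))))))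
    blend-zeros : {H : List (Fm Name (𝟙 ∷ Γ))} → H ⊢ v₀ ≈ blend · v₀ · zeros
    blend-zeros = ∀I (≐-sym (blend-zero (ax (base (Π-eq zer v₀)))))
    blend-above : {H : List (Fm Name (𝟘 ∷ 𝟙 ∷ Γ))} →
                  H ⊢ st v₀ ⇒ Binaryˢᵗ v₁ ⇒ blend · v₁ · (above · v₀) ≈ sgs · v₁
    blend-above = ⇒I (⇒I (∀I (case-nat (v₁ ∸ v₀)
      (≐-trans (blend-suc (above-≽ v₁ v₀ h₀)) (≐-sym (sgs-def v₂ v₀)))
      (blend · v₂ · (above · v₁) · v₀ ≐⟨ blend-zero (above-≺ v₁ v₀ h₀) ⟩
       -- Below the standard modulus the argument is standard, so the sequence is 0-1 valued there.
       v₂ · v₀        ≐⟨ sg-binaryˢᵗ v₂ v₀ h₁ (≼-st (≺⇒≼ (monus-≺ h₀)) h₂) ⟨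
       sg · (v₂ · v₀) ≐⟨ sgs-def v₂ v₀ ⟨
       sgs · v₂ · v₀  ■))))
    sgs-invariant′ : H ⊢ ∀̇ {σ = 𝟚} (∀̇ {σ = 𝟙}
      (𝔓 ⇒ st v₁ ⇒ st v₀ ⇒ Binaryˢᵗ v₀ ⇒ v₁ · v₀ ≐ v₁ · (sgs · v₀)))
    sgs-invariant′ = ∀I (∀I (⇒I (⇒I (⇒I (⇒I (∃E
      (⇒E (∀E h₃ (precompose-blend · v₁ · v₀))
          (app-st (app-st (closed-st precompose-blend) h₂) h₁))
      (v₂ · v₁                                ≐⟨ ≈-cong v₂ {v₁} {blend · v₁ · zeros} (inst-blend v₁) ⟩
       v₂ · (blend · v₁ · zeros)              ≐⟨ precompose-blend-def v₂ v₁ zeros ⟨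
       precompose-blend · v₂ · v₁ · zeros
         ≐⟨ modulus (precompose-blend · v₂ · v₁) v₀ zeros (above · v₀) (∧E₂ h₀)
              binary-zeros binary-above bar-above ⟩
       precompose-blend · v₂ · v₁ · (above · v₀) ≐⟨ precompose-blend-def v₂ v₁ (above · v₀) ⟩
       v₂ · (blend · v₁ · (above · v₀))
         ≐⟨ ≈-cong v₂ {blend · v₁ · (above · v₀)} {sgs · v₁} (⇒E (⇒E blend-above (∧E₁ h₀)) h₁) ⟩
       v₂ · (sgs · v₁)                        ■)))))))
      where
      inst-blend : (f : Term Name Γ 𝟙) → H ⊢ f ≈ blend · f · zeros
      inst-blend f = ∀E (∀I blend-zeros) f

  total : Term Name Γ ((𝟚 ⟶ 𝟘 *) ⟶ 𝟛)
  total = ƛ (ƛ (sum · (con at · (v₁ · v₀)) · (con len · (v₁ · v₀))))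

  total-def : (Φ : Term Name Γ (𝟚 ⟶ 𝟘 *)) (φ : Term Name Γ 𝟚) →
              H ⊢ total · Φ · φ ≐ sum · (con at · (Φ · φ)) · (con len · (Φ · φ))
  total-def = β₂ (sum · (con at · (v₁ · v₀)) · (con len · (v₁ · v₀)))

  ∈̇⇒≼-sum : (t : Term Name Γ 𝟘) (l : Term Name Γ (𝟘 *)) →
            H ⊢ t ∈̇ l → H ⊢ t ≼ sum · (con at · l) · (con len · l)
  ∈̇⇒≼-sum t l = ⇒E (inst₂ ∈̇⇒≼-sum′ t l)
    where
    ∈̇⇒≼-sum′ : H ⊢ ∀̇ {σ = 𝟘} (∀̇ {σ = 𝟘 *}
      (v₁ ∈̇ v₀ ⇒ v₁ ≼ sum · (con at · v₀) · (con len · v₀)))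
    ∈̇⇒≼-sum′ = ∀I (∀I (⇒I (∃E (⇒E (∧E₁ (∃<-def _ _)) h₀)
      (≼-cong (≐-sym (∧E₂ h₀)) (≐-refl _) (≼-sum (∧E₁ h₀))))))

  𝔓⇒MUCˢᵗ : H ⊢ 𝔓 ⇒ MUC ˢᵗ
  𝔓⇒MUCˢᵗ = ⇒I (∃E (⇒E (ax (HAC-int (IsModulus v₁ v₀) _)) h₀)
    (∃I (total · v₀) (∧I (app-st (closed-st total) (∧E₁ h₀))
      (∀I (⇒I (∃E (⇒E (∀E (∧E₂ h₁) v₀) h₀)
        (∀I (⇒I (∀I (⇒I (⇒I (⇒I
          -- The modulus `v₂` from the list speaks only of sequences that are 0-1 valued everywhere,
          -- so both sequences are passed through `sgs` first. Agreement up to the sum of the list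
          -- restricts to agreement up to `v₂`.
          (v₃ · v₁         ≐⟨ sgs-invariant v₃ v₁ h₇ h₅ h₃ (∧E₁ h₁) ⟩
           v₃ · (sgs · v₁)
             ≐⟨ modulus v₃ v₂ (sgs · v₁) (sgs · v₀) (∧E₂ h₄) (binary-sgs v₁) (binary-sgs v₀)
                  (bar-sgs v₁ v₀ v₂ (bar-restrict h₀
                    (≼-cong (≐-refl v₂) (≐-sym (total-def v₄ v₃))
                      (∈̇⇒≼-sum v₂ (v₄ · v₃) (∧E₁ h₄))))) ⟩
           v₃ · (sgs · v₀) ≐⟨ sgs-invariant v₃ v₀ h₇ h₅ h₂ (∧E₂ h₁) ⟨
           v₃ · v₀         ■)))))))))))))

  -- Least standard moduli, the constant `Ω₀`, and transfer.

  fanˢᵗ : Term Name Γ (𝟛 ⟶ 𝟛)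
  fanˢᵗ = ƛ (ƛ (least · v₀ · (bound · (v₁ · v₀)) · (v₁ · v₀)))

  fanˢᵗ-def : (ω : Term Name Γ 𝟛) (φ : Term Name Γ 𝟚) →
              H ⊢ fanˢᵗ · ω · φ ≐ least · φ · (bound · (ω · φ)) · (ω · φ)
  fanˢᵗ-def = β₂ (least · v₀ · (bound · (v₁ · v₀)) · (v₁ · v₀))

  -- If the search has run all the way up to `ω · φ`, that number is itself free of defects, being a
  -- standard modulus.
  fanˢᵗ-defects : (ω : Term Name Γ 𝟛) (φ : Term Name Γ 𝟚) →
                  H ⊢ st ω → H ⊢ st φ → H ⊢ IsModulusˢᵗ φ (ω · φ) →
                  H ⊢ defects · φ · (bound · (ω · φ)) · (fanˢᵗ · ω · φ) ≐ zer
  fanˢᵗ-defects ω φ p q m = ≐-trans (cong₁ (defects · φ · K) (fanˢᵗ-def ω φ))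
    (cut (modulusˢᵗ-defects φ K (ω · φ) m (app-st p q)
           (app-st (closed-st bound) (app-st p q)))
      (∨E (least-sound φ K (ω · φ)) h₀
        (≐-trans (cong₁ (defects · φ · K) h₀) h₁)))
    where
    K = bound · (ω · φ)

  fanˢᵗ-modulus : (ω : Term Name Γ 𝟛) (φ : Term Name Γ 𝟚) →
                  H ⊢ st ω → H ⊢ st φ → H ⊢ IsModulusˢᵗ φ (ω · φ) →
                  H ⊢ IsModulusˢᵗ φ (fanˢᵗ · ω · φ)
  fanˢᵗ-modulus ω φ p q m =
    restrict-modulusˢᵗ φ (fanˢᵗ · ω · φ) (ω · φ) m (app-st p q)
      (≼-cong (≐-sym (fanˢᵗ-def ω φ)) (≐-refl (ω · φ)) (least-≼ φ _ (ω · φ)))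
      (fanˢᵗ-defects ω φ p q m)

  -- Any standard modulus t passes the tests, however it compares with `ω · φ`, and thus stops the
  -- search.
  fanˢᵗ-minimal : (ω : Term Name Γ 𝟛) (φ : Term Name Γ 𝟚) (t : Term Name Γ 𝟘) →
                  H ⊢ st ω → H ⊢ st φ → H ⊢ st t → H ⊢ IsModulusˢᵗ φ t →
                  H ⊢ fanˢᵗ · ω · φ ≼ t
  fanˢᵗ-minimal ω φ t p q r m =
    ≼-cong (≐-sym (fanˢᵗ-def ω φ)) (≐-refl t)
      (least-minimal (modulusˢᵗ-defects φ _ t m r
        (app-st (closed-st bound) (app-st p q))))

  Modulatesˢᵗ : Term Name Γ 𝟛 → Fm Name Γ
  Modulatesˢᵗ ω = ∀ˢᵗ (IsModulusˢᵗ v₀ (wk ω · v₀))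

  -- `fanˢᵗ` turns a standard fan functional into one satisfying `M` relativised to `st`. The axiom
  -- for `Ω₀` then identifies the two, but only at standard arguments.
  Ω₀-fanˢᵗ : {H : List (Fm Name (𝟛 ∷ Γ))} →
             st v₀ ∧ Modulatesˢᵗ v₀ ∷ H ⊢ ∀ˢᵗ (con Ω₀ · v₀ ≐ fanˢᵗ · v₁ · v₀)
  Ω₀-fanˢᵗ =
    ⇒E (⇒E (∀E (∧E₂ (ax Ω₀-axiom)) (fanˢᵗ · v₀)) (app-st (closed-st fanˢᵗ) (∧E₁ h₀)))
       (∧I (∀I (⇒I (fanˢᵗ-modulus v₁ v₀ (∧E₁ h₁) h₀ (⇒E (∀E (∧E₂ h₁) v₀) h₀))))
           (∀I (⇒I (∀I (⇒I (⇒I (fanˢᵗ-minimal v₂ v₁ v₀ (∧E₁ h₃) h₂ h₁ h₀)))))))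

  Ω₀-modulatesˢᵗ : MUC ˢᵗ ∷ H ⊢ Modulatesˢᵗ (con Ω₀)
  Ω₀-modulatesˢᵗ = ∃E h₀ (cut Ω₀-fanˢᵗ (∀I (⇒I (cut (⇒E (∀E h₁ v₀) h₀)
    (∀I (⇒I (∀I (⇒I (⇒I (⇒I
      (modulusˢᵗ v₂ (fanˢᵗ · v₃ · v₂) v₁ v₀
        (fanˢᵗ-modulus v₃ v₂ (∧E₁ h₇) h₅ (⇒E (∀E (∧E₂ h₇) v₂) h₅))
        h₃ h₂ (∧E₁ h₁) (∧E₂ h₁)
        -- The initial segments are given at the length chosen by `Ω₀`; at this standard φ it equals
        -- the length chosen by `fanˢᵗ`.
        (≐-trans (cong₁ (initial · v₁) (≐-sym h₄))
          (≐-trans h₀ (cong₁ (initial · v₀) h₄))))))))))))))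

  -- Triples (f, g, φ) are coded in one type, as PF-TP∀ transfers a single quantifier.
  Triple : Type
  Triple = (𝟙 ⟶ 𝟙 ⟶ 𝟚 ⟶ 𝟘) ⟶ 𝟘

  triple : Term Name Γ (𝟙 ⟶ 𝟙 ⟶ 𝟚 ⟶ Triple)
  triple = ƛ (ƛ (ƛ (ƛ (v₀ · v₃ · v₂ · v₁))))

  -- A triple is coded by evaluation: it feeds its components to a function with values in `𝟘`. A
  -- projection therefore takes the argument of its component as well and asks for the value there.
  π₁ π₂ : Term Name Γ (Triple ⟶ 𝟙)
  π₁ = ƛ (ƛ (v₁ · ƛ (ƛ (ƛ (v₂ · v₃)))))
  π₂ = ƛ (ƛ (v₁ · ƛ (ƛ (ƛ (v₁ · v₃)))))

  π₃ : Term Name Γ (Triple ⟶ 𝟚)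
  π₃ = ƛ (ƛ (v₁ · ƛ (ƛ (ƛ (v₀ · v₃)))))

  project : (f g : Term Name Γ 𝟙) (φ : Term Name Γ 𝟚) (t : Term Name Γ σ)
            (e : Term Name (𝟚 ∷ 𝟙 ∷ 𝟙 ∷ σ ∷ Triple ∷ Γ) 𝟘) →
            H ⊢ ƛ (ƛ (v₁ · ƛ (ƛ (ƛ e)))) · (triple · f · g · φ) · t ≐
                subᵗ (var ▸ (triple · f · g · φ) ▸ t ▸ f ▸ g ▸ φ) e
  project f g φ t e =
    ≐-trans (β₂ (v₁ · ƛ (ƛ (ƛ e))) p t)
      (≐-trans (ƛ-app (var ▸ f ▸ g ▸ φ) (v₀ · v₃ · v₂ · v₁) (β₃ (ƛ (v₀ · v₃ · v₂ · v₁)) f g φ) c)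
        (ƛ-app (ς ▸ f ▸ g) e (ƛ-app (ς ▸ f) (ƛ e) (β ς (ƛ (ƛ e)) f) g) φ))
    where
    p = triple · f · g · φ
    ς : Sub Name _ _
    ς = var ▸ p ▸ t
    c = subᵗ ς (ƛ (ƛ (ƛ e)))

  π₁-triple : (f g : Term Name Γ 𝟙) (φ : Term Name Γ 𝟚) →
              H ⊢ π₁ · (triple · f · g · φ) ≈ f
  π₁-triple f g φ = inst₃ π₁-triple′ f g φ
    where
    π₁-triple′ : H ⊢ ∀̇ {σ = 𝟙} (∀̇ {σ = 𝟙} (∀̇ {σ = 𝟚} (π₁ · (triple · v₂ · v₁ · v₀) ≈ v₂)))
    π₁-triple′ = ∀I (∀I (∀I (∀I (project v₃ v₂ v₁ v₀ (v₂ · v₃)))))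

  π₂-triple : (f g : Term Name Γ 𝟙) (φ : Term Name Γ 𝟚) →
              H ⊢ π₂ · (triple · f · g · φ) ≈ g
  π₂-triple f g φ = inst₃ π₂-triple′ f g φ
    where
    π₂-triple′ : H ⊢ ∀̇ {σ = 𝟙} (∀̇ {σ = 𝟙} (∀̇ {σ = 𝟚} (π₂ · (triple · v₂ · v₁ · v₀) ≈ v₁)))
    π₂-triple′ = ∀I (∀I (∀I (∀I (project v₃ v₂ v₁ v₀ (v₁ · v₃)))))

  π₃-triple : (f g : Term Name Γ 𝟙) (φ : Term Name Γ 𝟚) →
              H ⊢ π₃ · (triple · f · g · φ) ≈ φ
  π₃-triple f g φ = inst₃ π₃-triple′ f g φ
    where
    π₃-triple′ : H ⊢ ∀̇ {σ = 𝟙} (∀̇ {σ = 𝟙} (∀̇ {σ = 𝟚} (π₃ · (triple · v₂ · v₁ · v₀) ≈ v₀)))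
    π₃-triple′ = ∀I (∀I (∀I (∀I (project v₃ v₂ v₁ v₀ (v₀ · v₃)))))

  binary-cong : (f g : Term Name Γ 𝟙) → H ⊢ f ≈ g → H ⊢ Binary f → H ⊢ Binary g
  binary-cong f g p q = ⇒E (⇒E (inst₂ binary-cong′ f g) p) q
    where
    binary-cong′ : H ⊢ ∀̇ {σ = 𝟙} (∀̇ {σ = 𝟙} (v₁ ≈ v₀ ⇒ Binary v₁ ⇒ Binary v₀))
    binary-cong′ = ∀I (∀I (⇒I (⇒I (∀I (≼-cong (∀E h₁ v₀) (≐-refl one) (∀E h₀ v₀))))))

  Ω₀-modulates-at : Term Name Γ 𝟙 → Term Name Γ 𝟙 → Term Name Γ 𝟚 → Fm Name Γ
  Ω₀-modulates-at f g φ = Binary f ∧ Binary g ⇒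
    (bar f (con Ω₀ · φ) ≐ bar g (con Ω₀ · φ) ⇒ φ · f ≐ φ · g)

  Ω₀-modulates-triple : Fm Name (Triple ∷ [])
  Ω₀-modulates-triple = Ω₀-modulates-at (π₁ · v₀) (π₂ · v₀) (π₃ · v₀)

  MUCˢᵗ⇒MUC : H ⊢ MUC ˢᵗ ⇒ MUC
  MUCˢᵗ⇒MUC = ⇒I (cut Ω₀-modulatesˢᵗ (cut (⇒E (ax (PF-TP∀ Ω₀-modulates-triple _))
      (∀I (⇒I (⇒I (⇒I
        -- The transferred formula is internal and so has `Binary` unrelativised. That premise is
        -- stronger than its relativised form, so the modulus property on standard sequences
        -- suffices for a standard triple.
        (modulusˢᵗ (π₃ · v₀) (con Ω₀ · (π₃ · v₀)) (π₁ · v₀) (π₂ · v₀)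
          (⇒E (∀E h₃ (π₃ · v₀)) (app-st (closed-st π₃) h₂))
          (app-st (closed-st π₁) h₂) (app-st (closed-st π₂) h₂)
          (binary⇒binaryˢᵗ (π₁ · v₀) (∧E₁ h₁)) (binary⇒binaryˢᵗ (π₂ · v₀) (∧E₂ h₁))
          h₀))))))
    (∃I (con Ω₀) (∀I (∀I (∀I (⇒I (⇒I
      -- The projections of `p` return the components only up to `_≈_`, so each part of the
      -- transferred formula is carried over by extensionality.
      (cut (∀E h₂ p) (v₂ · v₁                ≐⟨ ·-cong {f = π₃ · p} {v₂} {π₁ · p} {v₁} P₃ P₁ ⟨
        (π₃ · p) · (π₁ · p)  ≐⟨ ⇒E (⇒E h₀ (∧I
            (binary-cong v₁ (π₁ · p) (≈-sym {x = π₁ · p} {v₁} P₁) (∧E₁ h₂))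
            (binary-cong v₀ (π₂ · p) (≈-sym {x = π₂ · p} {v₀} P₂) (∧E₂ h₂))))
          (≐-trans (bar-P v₁ (π₁ · p) P₁) (≐-trans h₁ (≐-sym (bar-P v₀ (π₂ · p) P₂)))) ⟩
        (π₃ · p) · (π₂ · p)  ≐⟨ ·-cong {f = π₃ · p} {v₂} {π₂ · p} {v₀} P₃ P₂ ⟩
        v₂ · v₀              ■))))))))))
    where
    p : Term Name (𝟙 ∷ 𝟙 ∷ 𝟚 ∷ Γ) Triple
    p = triple · v₁ · v₀ · v₂
    P₁ : {H : List (Fm Name (𝟙 ∷ 𝟙 ∷ 𝟚 ∷ Γ))} → H ⊢ π₁ · p ≈ v₁
    P₁ = π₁-triple v₁ v₀ v₂
    P₂ : {H : List (Fm Name (𝟙 ∷ 𝟙 ∷ 𝟚 ∷ Γ))} → H ⊢ π₂ · p ≈ v₀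
    P₂ = π₂-triple v₁ v₀ v₂
    P₃ : {H : List (Fm Name (𝟙 ∷ 𝟙 ∷ 𝟚 ∷ Γ))} → H ⊢ π₃ · p ≈ v₂
    P₃ = π₃-triple v₁ v₀ v₂
    bar-P : {H : List (Fm Name (𝟙 ∷ 𝟙 ∷ 𝟚 ∷ Γ))} (f g : Term Name (𝟙 ∷ 𝟙 ∷ 𝟚 ∷ Γ) 𝟙) → H ⊢ g ≈ f →
            H ⊢ bar g (con Ω₀ · (π₃ · p)) ≐ bar f (con Ω₀ · v₂)
    bar-P f g q = ≐-trans (≈-app (≈-cong initial {g} {f} q) (con Ω₀ · (π₃ · p)))
      (cong₁ (initial · f) (≈-cong (con Ω₀) {π₃ · p} {v₂} P₃))

corollary4p2 : (𝒮 : SpecialConstants) →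
    RCA₀^Ω-Proves 𝒮 ((MUC ⇔ MUC ˢᵗ) ∧ (MUC ˢᵗ ⇔ 𝔓))
corollary4p2 𝒮 =
  ∧I (∧I (⇒I (⇒E 𝔓⇒MUCˢᵗ (⇒E MUC⇒𝔓 h₀))) MUCˢᵗ⇒MUC)
     (∧I (⇒I (⇒E MUC⇒𝔓 (⇒E MUCˢᵗ⇒MUC h₀))) 𝔓⇒MUCˢᵗ)
  where open Derivations 𝒮
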